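{- Let $s\geq 2$ and $r\geq 3$ be integers and let $G$ be a bipartite graph with an ordered bipartition $(X,Y)$ such that every vertex in $Y$ has degree at most $s$. Then, for all positive integers $n$, $$\mathrm{ex}(n,G_{X,Y}^{(r)})\leq Cn^{r-\frac{1}{s-1}},$$ where $C$ is a constant that depends only on $G$ (with its ordered bipartition) and $r$.
   Context: All graphs are finite. For an $r$-uniform hypergraph $H$, $\mathrm{ex}(n,H)$ denotes the largest number of edges in an $r$-uniform hypergraph on $n$ vertices containing no copy of $H$ (as a not necessarily induced subhypergraph). For a bipartite graph $G$ with ordered bipartition $(X,Y)$, $Y=\{y_1,\dots,y_m\}$, $G_{X,Y}^{(r)}$ is the $r$-uniform hypergraph whose vertex set is the union of pairwise disjoint sets $X,Y_1,\dots,Y_m$ with $|Y_1|=\dots=|Y_m|=r-1$, and whose edge set is $\{\{x\}\cup Y_i : x\in X,\ \{x,y_i\}\in E(G)\}$. -}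

module Defs where

open import Data.Bool using (Bool; T)
open import Data.Bool.Properties using (T?)
open import Data.Fin using (Fin; zero; suc)
open import Data.Fin.Properties using (any?; _≟_)
open import Data.Fin.Subset using (Subset; _∈_; ⁅_⁆; ⊤; ⊥; ∣_∣; inside; outside)
open import Data.Fin.Subset.Properties using (_∈?_; ∣⁅x⁆∣≡1; ∣⊤∣≡n; ∣⊥∣≡0; x∈⁅x⁆; x∈⁅y⁆⇒x≡y)
open import Data.List using (List; length; map; filter; allFin; cartesianProduct)
open import Data.List.Membership.Propositional using () renaming (_∈_ to _∈ˡ_)
open import Data.List.Relation.Unary.All using (All; universal)
import Data.List.Relation.Unary.All.Properties as All
open import Data.List.Relation.Unary.Unique.Propositional using (Unique)
import Data.List.Relation.Unary.Unique.Propositional.Properties as Unique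
open import Data.Nat using (ℕ; zero; suc; _+_; _*_; _∸_; _^_; _≤_; s≤s)
open import Data.Nat.Properties using (+-identityʳ)
open import Data.Product using (_×_; _,_; ∃-syntax)
open import Data.Vec using ([]; _∷_; _++_; concat; replicate; tabulate; _[_]≔_)
open import Data.Vec.Properties using (++-injectiveˡ; ++-injectiveʳ)
open import Function.Definitions using (Injective)
open import Level using (0ℓ)
open import Relation.Binary.PropositionalEquality using (_≡_; refl; trans; cong; cong₂; subst)
open import Relation.Nullary using (¬_; does; _×-dec_)
open import Relation.Unary using (Pred; Decidable)

-- The vertex set is Fin n; the finite edge set is a duplicate-free list.
record Hypergraph (r n : ℕ) : Set where
  field
    edges   : List (Subset n)
    unique  : Unique edges
    uniform : All (λ e → ∣ e ∣ ≡ r) edges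

open Hypergraph public

∣E_∣ : ∀ {r n} → Hypergraph r n → ℕ
∣E H ∣ = length (edges H)

image : ∀ {m n} → (Fin m → Fin n) → Subset m → Subset n
image f p = tabulate λ v → does (any? λ u → (u ∈? p) ×-dec (f u ≟ v))

record Copy {r m n} (H : Hypergraph r m) (F : Hypergraph r n) : Set where
  field
    embed     : Fin m → Fin n
    injective : Injective _≡_ _≡_ embed
    preserves : ∀ e → e ∈ˡ edges H → image embed e ∈ˡ edges F

_-Free_ : ∀ {r m n} → Hypergraph r m → Hypergraph r n → Set
H -Free F = ¬ Copy H F

-- "ex(n, H) = k". This is a relation because no such k exists when every
-- n-vertex hypergraph contains H, i.e. when H has no edges and at most n vertices.
record IsEx {r m} (n : ℕ) (H : Hypergraph r m) (k : ℕ) : Set where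
  field
    attained : ∃[ F ] (H -Free F × ∣E_∣ {r} {n} F ≡ k)
    largest  : ∀ (F : Hypergraph r n) → H -Free F → ∣E F ∣ ≤ k

-- A finite bipartite graph with ordered bipartition (X, Y): X = Fin ∣X∣ and
-- Y = Fin ∣Y∣ are disjoint vertex classes, and all edges run between them.
record BipartiteGraph : Set where
  field
    ∣X∣ ∣Y∣ : ℕ
    adj     : Fin ∣X∣ → Fin ∣Y∣ → Bool

  neighboursOfY : Fin ∣Y∣ → Subset ∣X∣
  neighboursOfY y = tabulate λ x → adj x y

  degreeOfY : Fin ∣Y∣ → ℕ
  degreeOfY y = ∣ neighboursOfY y ∣

  Edge : Pred (Fin ∣X∣ × Fin ∣Y∣) 0ℓ
  Edge (x , y) = T (adj x y)

  edge? : Decidable Edge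
  edge? (x , y) = T? (adj x y)

-- The vertices b * k form b consecutive blocks of k vertices; this is block y.
block : ∀ b k → Fin b → Subset (b * k)
block b k y = concat (replicate b (⊥ {k}) [ y ]≔ ⊤)

private
  ∣++∣ : ∀ {m n} (p : Subset m) (q : Subset n) → ∣ p ++ q ∣ ≡ ∣ p ∣ + ∣ q ∣
  ∣++∣ []            q = refl
  ∣++∣ (inside  ∷ p) q = cong suc (∣++∣ p q)
  ∣++∣ (outside ∷ p) q = ∣++∣ p q

  ∣⊥s∣ : ∀ b k → ∣ concat (replicate b (⊥ {k})) ∣ ≡ 0
  ∣⊥s∣ zero    k = refl
  ∣⊥s∣ (suc b) k = trans (∣++∣ (⊥ {k}) _) (cong₂ _+_ (∣⊥∣≡0 k) (∣⊥s∣ b k))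

  ∣block∣ : ∀ b k y → ∣ block b k y ∣ ≡ k
  ∣block∣ (suc b) k zero    =
    trans (∣++∣ (⊤ {k}) _) (trans (cong₂ _+_ (∣⊤∣≡n k) (∣⊥s∣ b k)) (+-identityʳ k))
  ∣block∣ (suc b) k (suc y) =
    trans (∣++∣ (⊥ {k}) _) (cong₂ _+_ (∣⊥∣≡0 k) (∣block∣ b k y))

  block-injective : ∀ b k {y z} → block b (suc k) y ≡ block b (suc k) z → y ≡ z
  block-injective (suc b) k {zero}  {zero}  _  = refl
  block-injective (suc b) k {zero}  {suc z} ()
  block-injective (suc b) k {suc y} {zero}  ()
  block-injective (suc b) k {suc y} {suc z} eq =
    cong suc (block-injective b k (++-injectiveʳ (⊥ {suc k}) ⊥ eq))

  ⁅⁆-injective : ∀ {n} {x y : Fin n} → ⁅ x ⁆ ≡ ⁅ y ⁆ → x ≡ y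
  ⁅⁆-injective {x = x} {y} eq = x∈⁅y⁆⇒x≡y y (subst (λ p → x ∈ p) eq (x∈⁅x⁆ x))

module _ (G : BipartiteGraph) (r : ℕ) where
  open BipartiteGraph G

  -- X comes first, followed by the blocks Y₁, …, Yₘ of size r - 1.
  expansionOrder : ℕ
  expansionOrder = ∣X∣ + ∣Y∣ * (r ∸ 1)

  -- {x} ∪ Y_y, given by its characteristic vector.
  expansionEdge : Fin ∣X∣ × Fin ∣Y∣ → Subset expansionOrder
  expansionEdge (x , y) = ⁅ x ⁆ ++ block ∣Y∣ (r ∸ 1) y

  expansionEdges : List (Subset expansionOrder)
  expansionEdges = map expansionEdge (filter edge? (cartesianProduct (allFin ∣X∣) (allFin ∣Y∣)))

private
  expansionEdge-size : ∀ G r → 3 ≤ r → ∀ xy → ∣ expansionEdge G r xy ∣ ≡ r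
  expansionEdge-size G r (s≤s _) (x , y) =
    trans (∣++∣ ⁅ x ⁆ _) (cong₂ _+_ (∣⁅x⁆∣≡1 x) (∣block∣ _ _ y))

  expansionEdge-injective : ∀ G r → 3 ≤ r → Injective _≡_ _≡_ (expansionEdge G r)
  expansionEdge-injective G r (s≤s (s≤s _)) {x , y} {x′ , y′} eq = cong₂ _,_
    (⁅⁆-injective (++-injectiveˡ ⁅ x ⁆ ⁅ x′ ⁆ eq))
    (block-injective _ _ (++-injectiveʳ ⁅ x ⁆ ⁅ x′ ⁆ eq))

-- G_{X,Y}^{(r)}
expansion : (G : BipartiteGraph) (r : ℕ) → 3 ≤ r → Hypergraph r (expansionOrder G r)
expansion G r 3≤r = record
  { edges   = expansionEdges G r
  ; unique  = Unique.map⁺ (expansionEdge-injective G r 3≤r)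
                (Unique.filter⁺ edge?
                  (Unique.cartesianProduct⁺ (Unique.allFin⁺ ∣X∣) (Unique.allFin⁺ ∣Y∣)))
  ; uniform = All.map⁺ (universal (expansionEdge-size G r 3≤r) _)
  }
  where open BipartiteGraph G

-- The real inequality k ≤ C · n^(p/q), for q ≥ 1, with both (nonnegative)
-- sides raised to the q-th power.
_≤_·_^[_/_] : (k C n p q : ℕ) → Set
k ≤ C · n ^[ p / q ] = k ^ q ≤ C ^ q * n ^ p

module Submission where

-- Write M for the number of edges. List every edge as w ∷ x ∷ v ∷ z, with {x, v} a pair of
-- largest codegree d(x, v) inside it, and let D(y) be the set of w such that w ∷ y is such a
-- listing. Call an s-tuple S of vertices blocked if few vertices meet all y with S ⊆ D(y). If there
-- is no copy of the expansion, then a positive proportion of the s-tuples in every large D(y) is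
-- blocked: otherwise X fits into some D(y) with all relevant S unblocked, and disjoint Y_i are
-- chosen greedily. Count pairs (S, y) with S blocked and S ⊆ D(y), weighted by 1/d(x, v) for
-- y = x ∷ v ∷ z. Given S, some u ∈ y lies in the small transversal of S; with w ∈ S, there are at
-- most d(w, u) such y, and d(w, u) ≤ d(x, v) by the choice of {x, v}, so each of the boundedly many
-- u contributes at most 1 and the total is O(n^s). Conversely, the y for which |D(y)| is of order
-- at least d(x, v) / n^(r - 3) and M / n^(r - 1) carry half of the edges, so the total is of order
-- at least M^(s - 1) / n^(2 (s - 2) + (r - 3) (s - 1)).

open import Defs
open import Data.Bool.Properties using (T-≡)
open import Data.Fin using (Fin; zero; suc; toℕ; fromℕ<; inject≤; _↑ˡ_; _↑ʳ_; splitAt; join; combine; remQuot; punchOut)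
import Data.Fin.Properties as Fin
open import Data.Fin.Subset using (Subset; inside; outside; ∣_∣; ⁅_⁆; ⊤; ⊥) renaming (_∈_ to _∈ˢ_)
open import Data.Fin.Subset.Properties using (⊆-antisym; x∈⁅x⁆; x∈⁅y⁆⇒x≡y; ∣p∣≤n) renaming (_∈?_ to _∈ˢ?_)
open import Data.List using (List; []; _∷_; length; map; filter; allFin; cartesianProduct; cartesianProductWith) renaming (_++_ to _++ˡ_)
import Data.List.Membership.DecPropositional as Dec∈ˡ
open import Data.List.Membership.Propositional using (find; lose) renaming (_∈_ to _∈ˡ_; _∉_ to _∉ˡ_)
import Data.List.Membership.Propositional.Properties as ∈ˡ
open import Data.List.Properties using (length-map; length-++; length-tabulate)
open import Data.List.Relation.Binary.Permutation.Propositional using (_↭_; ↭-sym; ↭-trans; prep; ↭⇒↭ₛ)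
open import Data.List.Relation.Binary.Permutation.Propositional.Properties using (shift; ∈-resp-↭; ↭-length)
import Data.List.Relation.Binary.Permutation.Setoid.Properties as ↭ₛ
open import Data.List.Relation.Binary.Pointwise using (Pointwise; []; _∷_; Pointwise-length)
open import Data.List.Relation.Unary.All using () renaming (All to Allˡ; all? to allˡ?)
import Data.List.Relation.Unary.All as Allˡ
import Data.List.Relation.Unary.All.Properties as Allˡ
open import Data.List.Relation.Unary.AllPairs using ([]; _∷_)
open import Data.List.Relation.Unary.Any using (here; there) renaming (Any to Anyˡ; any? to anyˡ?)
open import Data.List.Relation.Unary.Unique.Propositional using () renaming (Unique to Uniqueˡ)
import Data.List.Relation.Unary.Unique.Propositional.Properties as Uniqueˡ
open import Data.Nat using (ℕ; zero; suc; _+_; _*_; _∸_; _^_; _/_; _!; _≤_; _<_; _<?_; _≤?_; z≤n; s≤s; NonZero; >-nonZero)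
open import Data.Nat.DivMod using (/-monoʳ-≤; m/n*n≤m; m*[n/m]≡n)
open import Data.Nat.Divisibility using (∣-trans; m∣m*n; m≤n⇒m!∣n!)
open import Data.Nat.Properties
open import Data.List.Extrema ≤-totalOrder using (argmax; argmax-all; f[xs]≤f[argmax])
open import Data.Nat.Tactic.RingSolver using (solve-∀)
open import Data.Product using (_×_; _,_; ∃-syntax; Σ-syntax; proj₁; proj₂; uncurry)
open import Data.Sum using (_⊎_; inj₁; inj₂)
open import Data.Vec using (Vec; []; _∷_; here; there; lookup; head; tail; toList; fromList; tabulate; insertAt; padRight; replicate; _++_; _[_]≔_)
open import Data.Vec.Membership.Propositional using (_∈_)
import Data.Vec.Membership.DecPropositional as Dec∈
open import Data.Vec.Membership.Propositional.Properties using (∈-toList⁺; ∈-fromList⁺; ∈-fromList⁻; ∈-lookup)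
open import Data.Vec.Properties using (≡-dec; ∷-injective; ∷-injectiveʳ; insertAt-lookup; insertAt-punchIn; tabulate-cong; length-toList; lookup∘tabulate; lookup-splitAt; lookup-++ˡ; lookup-++ʳ; lookup-concat; lookup∘update; lookup∘update′; lookup-replicate; []=⇒lookup; lookup⇒[]=)
open import Data.Vec.Relation.Unary.All using (All; []; _∷_; all?)
import Data.Vec.Relation.Unary.All as All
import Data.Vec.Relation.Unary.All.Properties as All
import Data.Vec.Relation.Unary.AllPairs as AllPairs
open import Data.Vec.Relation.Unary.Any using (index) renaming (here to hereᵛ; there to thereᵛ)
open import Data.Vec.Relation.Unary.Any.Properties using (lookup-index)
open import Data.Vec.Relation.Unary.Unique.Propositional using (Unique)
open import Data.Vec.Relation.Unary.Unique.Propositional.Properties using (lookup-injective)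
open import Function using (_∘_; id; _⇔_; mk⇔)
open import Function.Bundles using (module Equivalence)
open import Function.Definitions using (Injective)
open import Relation.Binary.Definitions using (DecidableEquality)
open import Relation.Binary.PropositionalEquality using (_≡_; _≢_; refl; sym; trans; cong; cong₂; subst; setoid; module ≡-Reasoning)
open import Relation.Nullary using (Dec; yes; no; does; ¬_; ¬?; _×-dec_; _→-dec_; contradiction)
open import Relation.Nullary.Decidable using (decidable-stable)
open import Relation.Unary using (Decidable)

private variable
  A B : Set
  P : Set
  n : ℕ

open Equivalence using (to; from)

-- Sums over lists

∑ : List A → (A → ℕ) → ℕ
∑ []       f = 0
∑ (x ∷ xs) f = f x + ∑ xs f

syntax ∑ xs (λ x → e) = ∑[ x ← xs ] e

𝟙 : Dec P → ℕ
𝟙 (yes _) = 1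
𝟙 (no _)  = 0

𝟙-yes : P → (P? : Dec P) → 1 ≤ 𝟙 P?
𝟙-yes p (yes _) = ≤-refl
𝟙-yes p (no ¬p) = contradiction p ¬p

𝟙≤1 : (P? : Dec P) → 𝟙 P? ≤ 1
𝟙≤1 (yes _) = ≤-refl
𝟙≤1 (no _)  = z≤n

𝟙*-mono : ∀ {k l} (P? : Dec P) → (P → k ≤ l) → 𝟙 P? * k ≤ l
𝟙*-mono {k = k} (yes p) h = ≤-trans (≤-reflexive (+-identityʳ k)) (h p)
𝟙*-mono         (no _)  h = z≤n

𝟙-mono : ∀ {k} (P? : Dec P) → (P → 1 ≤ k) → 𝟙 P? ≤ k
𝟙-mono (yes p) h = h p
𝟙-mono (no _)  h = z≤n

∑-mono : ∀ (xs : List A) {f g} → (∀ x → f x ≤ g x) → ∑ xs f ≤ ∑ xs g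
∑-mono []       h = z≤n
∑-mono (x ∷ xs) h = +-mono-≤ (h x) (∑-mono xs h)

∑-cong : ∀ (xs : List A) {f g} → (∀ x → f x ≡ g x) → ∑ xs f ≡ ∑ xs g
∑-cong []       h = refl
∑-cong (x ∷ xs) h = cong₂ _+_ (h x) (∑-cong xs h)

∑-+ : ∀ (xs : List A) f g → ∑[ x ← xs ] (f x + g x) ≡ ∑ xs f + ∑ xs g
∑-+ []       f g = refl
∑-+ (x ∷ xs) f g rewrite ∑-+ xs f g = lemma (f x) (g x) (∑ xs f) (∑ xs g)
  where
  lemma : ∀ a b c d → a + b + (c + d) ≡ a + c + (b + d)
  lemma = solve-∀

∑-*ˡ : ∀ (xs : List A) c f → ∑[ x ← xs ] (c * f x) ≡ c * ∑ xs f
∑-*ˡ []       c f = sym (*-zeroʳ c)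
∑-*ˡ (x ∷ xs) c f rewrite ∑-*ˡ xs c f = sym (*-distribˡ-+ c (f x) _)

∑-*ʳ : ∀ (xs : List A) f c → ∑[ x ← xs ] (f x * c) ≡ ∑ xs f * c
∑-*ʳ xs f c = trans (∑-cong xs λ x → *-comm (f x) c) (trans (∑-*ˡ xs c f) (*-comm c _))

∑-const : ∀ (xs : List A) c → ∑[ _ ← xs ] c ≡ length xs * c
∑-const []       c = refl
∑-const (x ∷ xs) c = cong (c +_) (∑-const xs c)

∑-swap : ∀ (xs : List A) (ys : List B) (f : A → B → ℕ) →
  ∑[ x ← xs ] ∑[ y ← ys ] f x y ≡ ∑[ y ← ys ] ∑[ x ← xs ] f x y
∑-swap []       ys f = sym (trans (∑-const ys 0) (*-zeroʳ (length ys)))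
∑-swap (x ∷ xs) ys f =
  trans (cong (∑ ys (f x) +_) (∑-swap xs ys f)) (sym (∑-+ ys (f x) _))

∑-++ : ∀ (xs ys : List A) f → ∑ (xs ++ˡ ys) f ≡ ∑ xs f + ∑ ys f
∑-++ []       ys f = refl
∑-++ (x ∷ xs) ys f rewrite ∑-++ xs ys f = sym (+-assoc (f x) _ _)

∑-map : ∀ (g : A → B) xs f → ∑ (map g xs) f ≡ ∑ xs (f ∘ g)
∑-map g []       f = refl
∑-map g (x ∷ xs) f = cong (f (g x) +_) (∑-map g xs f)

∑-filter : ∀ {P : A → Set} (P? : Decidable P) xs f →
  ∑ (filter P? xs) f ≡ ∑[ x ← xs ] (𝟙 (P? x) * f x)
∑-filter P? []       f = refl
∑-filter P? (x ∷ xs) f with P? x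
... | yes _ = cong₂ _+_ (sym (+-identityʳ (f x))) (∑-filter P? xs f)
... | no _  = ∑-filter P? xs f

length≡∑ : ∀ (xs : List A) → length xs ≡ ∑[ _ ← xs ] 1
length≡∑ xs = sym (trans (∑-const xs 1) (*-identityʳ _))

length-filter≡∑ : ∀ {P : A → Set} (P? : Decidable P) xs →
  length (filter P? xs) ≡ ∑[ x ← xs ] 𝟙 (P? x)
length-filter≡∑ P? xs = trans (length≡∑ (filter P? xs))
  (trans (∑-filter P? xs _) (∑-cong xs λ x → *-identityʳ _))

f∈≤∑ : ∀ {x} {xs : List A} f → x ∈ˡ xs → f x ≤ ∑ xs f
f∈≤∑ f (here refl)            = m≤m+n _ _
f∈≤∑ f (there {x = y} x∈xs)   = ≤-trans (f∈≤∑ f x∈xs) (m≤n+m _ (f y))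

-- Every entry of `xs` cancels one occurrence of itself in `ys`: since `x` does not recur in `xs`,
-- the other entries of `xs` survive in `as ++ˡ bs`.
∑-⊆ : ∀ {xs ys : List A} f → Uniqueˡ xs → (∀ {x} → x ∈ˡ xs → x ∈ˡ ys) → ∑ xs f ≤ ∑ ys f
∑-⊆ {xs = []}     f _          _  = z≤n
∑-⊆ {xs = x ∷ xs} f (x∉ ∷ xs!) xs⊆ys with ∈ˡ.∈-∃++ (xs⊆ys (here refl))
... | as , bs , refl = begin
  f x + ∑ xs f              ≤⟨ +-monoʳ-≤ (f x) (∑-⊆ f xs! xs⊆) ⟩
  f x + ∑ (as ++ˡ bs) f     ≡⟨ cong (f x +_) (∑-++ as bs f) ⟩
  f x + (∑ as f + ∑ bs f)   ≡⟨ lemma (f x) (∑ as f) (∑ bs f) ⟩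
  ∑ as f + (f x + ∑ bs f)   ≡⟨ ∑-++ as (x ∷ bs) f ⟨
  ∑ (as ++ˡ x ∷ bs) f       ∎
  where
  open ≤-Reasoning
  lemma : ∀ a b c → a + (b + c) ≡ b + (a + c)
  lemma = solve-∀
  xs⊆ : ∀ {y} → y ∈ˡ xs → y ∈ˡ as ++ˡ bs
  xs⊆ y∈xs with ∈ˡ.∈-++⁻ as (xs⊆ys (there y∈xs))
  ... | inj₁ y∈as           = ∈ˡ.∈-++⁺ˡ y∈as
  ... | inj₂ (there y∈bs)   = ∈ˡ.∈-++⁺ʳ as y∈bs
  ... | inj₂ (here refl)    = contradiction refl (Allˡ.lookup x∉ y∈xs)

∑-cartesianProductWith : ∀ {C : Set} (g : A → B → C) xs ys f →
  ∑ (cartesianProductWith g xs ys) f ≡ ∑[ x ← xs ] ∑[ y ← ys ] f (g x y)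
∑-cartesianProductWith g []       ys f = refl
∑-cartesianProductWith g (x ∷ xs) ys f = trans (∑-++ (map (g x) ys) _ f)
  (cong₂ _+_ (∑-map (g x) ys f) (∑-cartesianProductWith g xs ys f))

-- Sums over tuples and over their restrictions

tuples : List A → ∀ k → List (Vec A k)
tuples xs zero    = [] ∷ []
tuples xs (suc k) = cartesianProductWith _∷_ xs (tuples xs k)

tuples-unique : ∀ {xs : List A} k → Uniqueˡ xs → Uniqueˡ (tuples xs k)
tuples-unique zero    xs! = Allˡ.[] ∷ []
tuples-unique (suc k) xs! =
  Uniqueˡ.cartesianProductWith⁺ _∷_ ∷-injective xs! (tuples-unique k xs!)

∈-tuples⁺ : ∀ {xs : List A} {k} {v : Vec A k} → All (_∈ˡ xs) v → v ∈ˡ tuples xs k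
∈-tuples⁺ []         = here refl
∈-tuples⁺ (px ∷ pxs) = ∈ˡ.∈-cartesianProductWith⁺ _∷_ px (∈-tuples⁺ pxs)

∈-tuples⁻ : ∀ (xs : List A) k {v : Vec A k} → v ∈ˡ tuples xs k → All (_∈ˡ xs) v
∈-tuples⁻ xs zero    {[]} _ = []
∈-tuples⁻ xs (suc k) v∈ with ∈ˡ.∈-cartesianProductWith⁻ _∷_ xs (tuples xs k) v∈
... | _ , _ , x∈ , v′∈ , refl = x∈ ∷ ∈-tuples⁻ xs k v′∈

∑-tuples-suc : ∀ (xs : List A) k f →
  ∑ (tuples xs (suc k)) f ≡ ∑[ x ← xs ] ∑[ v ← tuples xs k ] f (x ∷ v)
∑-tuples-suc xs k f = ∑-cartesianProductWith _∷_ xs (tuples xs k) f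

length-tuples : ∀ (xs : List A) k → length (tuples xs k) ≡ length xs ^ k
length-tuples xs zero    = refl
length-tuples xs (suc k) = begin
  length (tuples xs (suc k))              ≡⟨ length≡∑ (tuples xs (suc k)) ⟩
  ∑[ _ ← tuples xs (suc k) ] 1            ≡⟨ ∑-tuples-suc xs k _ ⟩
  ∑[ _ ← xs ] ∑[ _ ← tuples xs k ] 1      ≡⟨ ∑-const xs _ ⟩
  length xs * ∑[ _ ← tuples xs k ] 1      ≡⟨ cong (length xs *_) (length≡∑ (tuples xs k)) ⟨
  length xs * length (tuples xs k)        ≡⟨ cong (length xs *_) (length-tuples xs k) ⟩
  length xs ^ suc k                       ∎
  where open ≡-Reasoning

-- Sums commute, so the coordinate at any position `i` can be summed first; this is how `∑-tuples-⊙`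
-- takes out the position `σ zero`.
∑-tuples-insertAt : ∀ (xs : List A) k (i : Fin (suc k)) f →
  ∑ (tuples xs (suc k)) f ≡ ∑[ x ← xs ] ∑[ v ← tuples xs k ] f (insertAt v i x)
∑-tuples-insertAt xs k       zero    f = ∑-tuples-suc xs k f
∑-tuples-insertAt xs (suc k) (suc i) f = begin
  ∑ (tuples xs (suc (suc k))) f
    ≡⟨ ∑-tuples-suc xs (suc k) f ⟩
  ∑[ y ← xs ] ∑[ v ← tuples xs (suc k) ] f (y ∷ v)
    ≡⟨ ∑-cong xs (λ y → ∑-tuples-insertAt xs k i (f ∘ (y ∷_))) ⟩
  ∑[ y ← xs ] ∑[ x ← xs ] ∑[ v ← tuples xs k ] f (y ∷ insertAt v i x)
    ≡⟨ ∑-swap xs xs _ ⟩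
  ∑[ x ← xs ] ∑[ y ← xs ] ∑[ v ← tuples xs k ] f (y ∷ insertAt v i x)
    ≡⟨ ∑-cong xs (λ x → ∑-tuples-suc xs k (λ v → f (insertAt v (suc i) x))) ⟨
  ∑[ x ← xs ] ∑[ v ← tuples xs (suc k) ] f (insertAt v (suc i) x)
    ∎
  where open ≡-Reasoning

infixl 9 _⊙_

-- With tuples read as functions on positions, this is composition.
_⊙_ : ∀ {m k} → Vec A m → (Fin k → Fin m) → Vec A k
v ⊙ σ = tabulate (lookup v ∘ σ)

-- The restriction of a uniformly random tuple to distinct positions is again uniform: the `k`
-- positions outside the image of `σ` are free and give the factor `length xs ^ k`.
∑-tuples-⊙ : ∀ (xs : List A) s k (σ : Fin s → Fin (s + k)) → Injective _≡_ _≡_ σ → ∀ f →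
  ∑[ v ← tuples xs (s + k) ] f (v ⊙ σ) ≡ length xs ^ k * ∑ (tuples xs s) f
∑-tuples-⊙ xs zero    k σ σ-inj f = begin
  ∑[ _ ← tuples xs k ] f []     ≡⟨ ∑-const (tuples xs k) (f []) ⟩
  length (tuples xs k) * f []   ≡⟨ cong₂ _*_ (length-tuples xs k) (sym (+-identityʳ (f []))) ⟩
  length xs ^ k * (f [] + 0)    ∎
  where open ≡-Reasoning
∑-tuples-⊙ xs (suc s) k σ σ-inj f = begin
  ∑[ v ← tuples xs (suc s + k) ] f (v ⊙ σ)
    ≡⟨ ∑-tuples-insertAt xs (s + k) i₀ _ ⟩
  ∑[ x ← xs ] ∑[ v ← tuples xs (s + k) ] f (insertAt v i₀ x ⊙ σ)
    ≡⟨ ∑-cong xs (λ x → ∑-cong (tuples xs (s + k)) λ v → cong f (insertAt-⊙ v x)) ⟩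
  ∑[ x ← xs ] ∑[ v ← tuples xs (s + k) ] f (x ∷ v ⊙ σ′)
    ≡⟨ ∑-cong xs (λ x → ∑-tuples-⊙ xs s k σ′ σ′-inj (f ∘ (x ∷_))) ⟩
  ∑[ x ← xs ] (length xs ^ k * ∑[ u ← tuples xs s ] f (x ∷ u))
    ≡⟨ ∑-*ˡ xs (length xs ^ k) _ ⟩
  length xs ^ k * ∑[ x ← xs ] ∑[ u ← tuples xs s ] f (x ∷ u)
    ≡⟨ cong (length xs ^ k *_) (∑-tuples-suc xs s f) ⟨
  length xs ^ k * ∑ (tuples xs (suc s)) f
    ∎
  where
  open ≡-Reasoning
  i₀ = σ zero
  i₀≢ : ∀ j → i₀ ≢ σ (suc j)
  i₀≢ j eq with () ← σ-inj eq
  σ′ : Fin s → Fin (s + k)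
  σ′ j = punchOut (i₀≢ j)
  σ′-inj : Injective _≡_ _≡_ σ′
  σ′-inj {i} {j} eq with refl ← σ-inj (Fin.punchOut-injective (i₀≢ i) (i₀≢ j) eq) = refl
  insertAt-⊙ : ∀ v x → insertAt v i₀ x ⊙ σ ≡ x ∷ v ⊙ σ′
  insertAt-⊙ v x = cong₂ _∷_ (insertAt-lookup v i₀ x) (tabulate-cong λ j →
    trans (cong (lookup (insertAt v i₀ x)) (sym (Fin.punchIn-punchOut (i₀≢ j))))
          (insertAt-punchIn v i₀ x (σ′ j)))

^-distribʳ-* : ∀ s a b → (a * b) ^ s ≡ a ^ s * b ^ s
^-distribʳ-* zero    a b = refl
^-distribʳ-* (suc s) a b = trans (cong (a * b *_) (^-distribʳ-* s a b)) (interchange a b (a ^ s) (b ^ s))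
  where
  interchange : ∀ a b c d → a * b * (c * d) ≡ a * c * (b * d)
  interchange = solve-∀

-- Union bound

length-allFin : ∀ n → length (allFin n) ≡ n
length-allFin n = length-tabulate id

∑-allFin-const : ∀ n c → ∑[ _ ← allFin n ] c ≡ n * c
∑-allFin-const n c = trans (∑-const (allFin n) c) (cong (_* c) (length-allFin n))

module _ (_≟_ : DecidableEquality A) {D : List A} (D! : Uniqueˡ D) where

  ∑-𝟙≟≤1 : ∀ x → ∑[ y ← D ] 𝟙 (x ≟ y) ≤ 1
  ∑-𝟙≟≤1 x = begin
    ∑[ y ← D ] 𝟙 (x ≟ y)                ≡⟨ length-filter≡∑ (x ≟_) D ⟨
    length (filter (x ≟_) D)            ≡⟨ length≡∑ (filter (x ≟_) D) ⟩
    ∑[ _ ← filter (x ≟_) D ] 1          ≤⟨ ∑-⊆ _ (Uniqueˡ.filter⁺ (x ≟_) D!) ⊆[x] ⟩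
    1                                   ∎
    where
    open ≤-Reasoning
    ⊆[x] : ∀ {y} → y ∈ˡ filter (x ≟_) D → y ∈ˡ x ∷ []
    ⊆[x] y∈ = here (sym (proj₂ (∈ˡ.∈-filter⁻ (x ≟_) {xs = D} y∈)))

  -- After restriction to the two positions only pairs remain, and the first entry of a colliding
  -- pair determines the second.
  ∑-collisions : ∀ k {i j : Fin (2 + k)} → i ≢ j →
    ∑[ v ← tuples D (2 + k) ] 𝟙 (lookup v i ≟ lookup v j) ≤ length D ^ suc k
  ∑-collisions k {i} {j} i≢j = begin
    ∑[ v ← tuples D (2 + k) ] collide (v ⊙ ij)
      ≡⟨ ∑-tuples-⊙ D 2 k ij ij-inj collide ⟩
    length D ^ k * ∑ (tuples D 2) collide
      ≤⟨ *-monoʳ-≤ (length D ^ k) collide-bound ⟩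
    length D ^ k * length D
      ≡⟨ *-comm (length D ^ k) _ ⟩
    length D ^ suc k
      ∎
    where
    open ≤-Reasoning
    collide : Vec A 2 → ℕ
    collide (x ∷ y ∷ []) = 𝟙 (x ≟ y)
    ij : Fin 2 → Fin (2 + k)
    ij zero       = i
    ij (suc zero) = j
    ij-inj : Injective _≡_ _≡_ ij
    ij-inj {zero}     {zero}     _  = refl
    ij-inj {zero}     {suc zero} eq = contradiction eq i≢j
    ij-inj {suc zero} {zero}     eq = contradiction (sym eq) i≢j
    ij-inj {suc zero} {suc zero} _  = refl
    collide-bound : ∑ (tuples D 2) collide ≤ length D
    collide-bound = begin
      ∑ (tuples D 2) collide
        ≡⟨ ∑-tuples-suc D 1 collide ⟩
      ∑[ x ← D ] ∑[ v ← tuples D 1 ] collide (x ∷ v)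
        ≡⟨ ∑-cong D (λ x → trans (∑-tuples-suc D 0 (collide ∘ (x ∷_)))
             (∑-cong D λ y → +-identityʳ _)) ⟩
      ∑[ x ← D ] ∑[ y ← D ] 𝟙 (x ≟ y)
        ≤⟨ ∑-mono D ∑-𝟙≟≤1 ⟩
      ∑[ _ ← D ] 1
        ≡⟨ length≡∑ D ⟨
      length D ∎

  -- Union bound over the tuples v: each one has a repeated entry, which at most half of them do
  -- as D is large, or has a bad restriction v ⊙ σ y.
  many-bad-tuples : ∀ {m} s k (σ : Fin m → Fin (2 + s) → Fin (2 + s + k)) →
    (∀ y → Injective _≡_ _≡_ (σ y)) →
    {Bad : Vec A (2 + s) → Set} (Bad? : Decidable Bad) →
    (∀ v → Injective _≡_ _≡_ (lookup v) → ∃[ y ] Bad (v ⊙ σ y)) →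
    2 * ((2 + s + k) * (2 + s + k)) ≤ length D →
    length D ^ (2 + s) ≤ 2 * m * ∑[ S ← tuples D (2 + s) ] 𝟙 (Bad? S)
  many-bad-tuples {m} s k σ σ-inj {Bad} Bad? bad large =
    -- Cancelling `δ ^ k` passes from tuples of length `t` to restrictions of length `2 + s`.
    *-cancelʳ-≤ _ _ (δ ^ k) {{m^n≢0 δ k {{>-nonZero δ>0}}}} (begin
      δ ^ (2 + s) * δ ^ k          ≡⟨ ^-distribˡ-+-* δ (2 + s) k ⟨
      δ ^ t                        ≤⟨ +-cancelˡ-≤ (δ ^ t) _ _ doubled ⟩
      2 * (m * (δ ^ k * #bad))     ≡⟨ regroup m (δ ^ k) #bad ⟩
      2 * m * #bad * δ ^ k         ∎)
    where
    open ≤-Reasoning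
    δ = length D
    t = 2 + s + k
    #bad = ∑[ S ← tuples D (2 + s) ] 𝟙 (Bad? S)

    regroup : ∀ a b c → 2 * (a * (b * c)) ≡ 2 * a * c * b
    regroup = solve-∀

    δ>0 : 0 < δ
    δ>0 = ≤-trans (s≤s z≤n) large

    Collision : Vec A t → Fin t → Fin t → Set
    Collision v i j = i ≢ j × lookup v i ≡ lookup v j

    collision? : ∀ v i j → Dec (Collision v i j)
    collision? v i j = ¬? (i Fin.≟ j) ×-dec (lookup v i ≟ lookup v j)

    #collision : Vec A t → ℕ
    #collision v = ∑[ i ← allFin t ] ∑[ j ← allFin t ] 𝟙 (collision? v i j)

    collision-or-bad : ∀ v →
      1 ≤ #collision v + ∑[ y ← allFin m ] 𝟙 (Bad? (v ⊙ σ y))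
    collision-or-bad v with Fin.any? (λ i → Fin.any? λ j → collision? v i j)
    ... | yes (i , j , c) = ≤-trans (𝟙-yes c (collision? v i j)) (≤-trans
            (f∈≤∑ (𝟙 ∘ collision? v i) (∈ˡ.∈-allFin j)) (≤-trans
            (f∈≤∑ (λ i → ∑[ j ← allFin t ] 𝟙 (collision? v i j)) (∈ˡ.∈-allFin i)) (m≤m+n _ _)))
    ... | no ¬c = ≤-trans (𝟙-yes (proj₂ y-bad) (Bad? _)) (≤-trans
            (f∈≤∑ (λ y → 𝟙 (Bad? (v ⊙ σ y))) (∈ˡ.∈-allFin (proj₁ y-bad))) (m≤n+m _ (#collision v)))
      where
      y-bad = bad v λ {i} {j} eq →
        decidable-stable (i Fin.≟ j) λ i≢j → ¬c (i , j , i≢j , eq)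

    ∑-collision≤ : ∀ i j → ∑[ v ← tuples D t ] 𝟙 (collision? v i j) ≤ δ ^ suc (s + k)
    ∑-collision≤ i j with i Fin.≟ j
    ... | no i≢j = ≤-trans
            (∑-mono (tuples D t) λ v → 𝟙-mono (yes i≢j ×-dec (lookup v i ≟ lookup v j))
              λ (_ , eq) → 𝟙-yes eq (lookup v i ≟ lookup v j))
            (∑-collisions (s + k) i≢j)
    ... | yes i≡j = ≤-trans
            (∑-mono (tuples D t) {g = λ _ → 0} λ v →
              𝟙-mono (no (λ i≢j → i≢j i≡j) ×-dec (lookup v i ≟ lookup v j))
              λ (i≢j , _) → contradiction i≡j i≢j)
            (≤-trans (≤-reflexive (trans (∑-const (tuples D t) 0) (*-zeroʳ (length (tuples D t))))) z≤n)

    ∑-#collision : ∑ (tuples D t) #collision ≤ t * t * δ ^ suc (s + k)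
    ∑-#collision = begin
      ∑ (tuples D t) #collision
        ≡⟨ ∑-swap (tuples D t) (allFin t) _ ⟩
      ∑[ i ← allFin t ] ∑[ v ← tuples D t ] ∑[ j ← allFin t ] 𝟙 (collision? v i j)
        ≡⟨ ∑-cong (allFin t) (λ i → ∑-swap (tuples D t) (allFin t) _) ⟩
      ∑[ i ← allFin t ] ∑[ j ← allFin t ] ∑[ v ← tuples D t ] 𝟙 (collision? v i j)
        ≤⟨ ∑-mono (allFin t) (λ i → ∑-mono (allFin t) (∑-collision≤ i)) ⟩
      ∑[ i ← allFin t ] ∑[ j ← allFin t ] (δ ^ suc (s + k))
        ≡⟨ trans (∑-allFin-const t (∑[ _ ← allFin t ] (δ ^ suc (s + k)))) (cong (t *_) (∑-allFin-const t (δ ^ suc (s + k)))) ⟩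
      t * (t * δ ^ suc (s + k))
        ≡⟨ *-assoc t t (δ ^ suc (s + k)) ⟨
      t * t * δ ^ suc (s + k)
        ∎

    union-bound : δ ^ t ≤ t * t * δ ^ suc (s + k) + m * (δ ^ k * #bad)
    union-bound = begin
      δ ^ t
        ≡⟨ length-tuples D t ⟨
      length (tuples D t)
        ≡⟨ length≡∑ (tuples D t) ⟩
      ∑[ _ ← tuples D t ] 1
        ≤⟨ ∑-mono (tuples D t) collision-or-bad ⟩
      ∑[ v ← tuples D t ] (#collision v + ∑[ y ← allFin m ] 𝟙 (Bad? (v ⊙ σ y)))
        ≡⟨ ∑-+ (tuples D t) #collision _ ⟩
      ∑ (tuples D t) #collision + ∑[ v ← tuples D t ] ∑[ y ← allFin m ] 𝟙 (Bad? (v ⊙ σ y))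
        ≡⟨ cong (∑ (tuples D t) #collision +_) (∑-swap (tuples D t) (allFin m) _) ⟩
      ∑ (tuples D t) #collision + ∑[ y ← allFin m ] ∑[ v ← tuples D t ] 𝟙 (Bad? (v ⊙ σ y))
        ≡⟨ cong (∑ (tuples D t) #collision +_)
             (∑-cong (allFin m) λ y → ∑-tuples-⊙ D (2 + s) k (σ y) (σ-inj y) (𝟙 ∘ Bad?)) ⟩
      ∑ (tuples D t) #collision + ∑[ _ ← allFin m ] (δ ^ k * #bad)
        ≤⟨ +-mono-≤ ∑-#collision (≤-reflexive (∑-allFin-const m _)) ⟩
      t * t * δ ^ suc (s + k) + m * (δ ^ k * #bad)
        ∎

    -- By `large`, `2 * (t * t) ≤ δ`, so in twice the union bound the collision term is at most one
    -- copy of `δ ^ t`.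
    doubled : δ ^ t + δ ^ t ≤ δ ^ t + 2 * (m * (δ ^ k * #bad))
    doubled = begin
      δ ^ t + δ ^ t                                                ≡⟨ twice (δ ^ t) ⟨
      2 * δ ^ t                                                    ≤⟨ *-monoʳ-≤ 2 union-bound ⟩
      2 * (t * t * δ ^ suc (s + k) + m * (δ ^ k * #bad))           ≡⟨ expand (t * t) (δ ^ suc (s + k)) _ ⟩
      2 * (t * t) * δ ^ suc (s + k) + 2 * (m * (δ ^ k * #bad))     ≤⟨ +-monoˡ-≤ _ (*-monoˡ-≤ (δ ^ suc (s + k)) large) ⟩
      δ ^ t + 2 * (m * (δ ^ k * #bad))                             ∎
      where
      twice : ∀ a → 2 * a ≡ a + a
      twice = solve-∀
      expand : ∀ a b c → 2 * (a * b + c) ≡ 2 * a * b + 2 * c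
      expand = solve-∀

-- Weighted counting

_∈?_ : ∀ {k} (a : Fin n) (τ : Vec (Fin n) k) → Dec (a ∈ τ)
a ∈? τ = Dec∈._∈?_ Fin._≟_ a τ

_∈ˡ?_ : ∀ {k} (τ : Vec (Fin n) k) T → Dec (τ ∈ˡ T)
τ ∈ˡ? T = Dec∈ˡ._∈?_ (≡-dec Fin._≟_) τ T

∑-𝟙∈≤ : ∀ {k} (τ : Vec (Fin n) k) → ∑[ a ← allFin n ] 𝟙 (a ∈? τ) ≤ k
∑-𝟙∈≤ {n} {k} τ = begin
  ∑[ a ← allFin n ] 𝟙 (a ∈? τ)          ≡⟨ length-filter≡∑ (_∈? τ) (allFin n) ⟨
  length (filter (_∈? τ) (allFin n))    ≡⟨ length≡∑ (filter (_∈? τ) (allFin n)) ⟩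
  ∑[ _ ← filter (_∈? τ) (allFin n) ] 1  ≤⟨ ∑-⊆ _ (Uniqueˡ.filter⁺ (_∈? τ) (Uniqueˡ.allFin⁺ n))
                                             (λ a∈ → ∈-toList⁺ (proj₂ (∈ˡ.∈-filter⁻ (_∈? τ) {xs = allFin n} a∈))) ⟩
  ∑[ _ ← toList τ ] 1                   ≡⟨ length≡∑ (toList τ) ⟨
  length (toList τ)                     ≡⟨ length-toList τ ⟩
  k                                     ∎
  where open ≤-Reasoning

∑-tuples-filter : ∀ {P : A → Set} (P? : Decidable P) {xs} → Uniqueˡ xs → ∀ k f →
  ∑ (tuples (filter P? xs) k) f ≤ ∑[ v ← tuples xs k ] (𝟙 (all? P? v) * f v)
∑-tuples-filter P? {xs} xs! k f = begin
  ∑ (tuples (filter P? xs) k) f                 ≤⟨ ∑-⊆ f (tuples-unique k (Uniqueˡ.filter⁺ P? xs!)) ⊆ ⟩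
  ∑ (filter (all? P?) (tuples xs k)) f          ≡⟨ ∑-filter (all? P?) (tuples xs k) f ⟩
  ∑[ v ← tuples xs k ] (𝟙 (all? P? v) * f v)    ∎
  where
  open ≤-Reasoning
  ⊆ : ∀ {v} → v ∈ˡ tuples (filter P? xs) k → v ∈ˡ filter (all? P?) (tuples xs k)
  ⊆ v∈ = ∈ˡ.∈-filter⁺ (all? P?) (∈-tuples⁺ (All.map (proj₁ ∘ ∈ˡ.∈-filter⁻ P?) pxs))
           (All.map (proj₂ ∘ ∈ˡ.∈-filter⁻ P? {xs = xs}) pxs)
    where pxs = ∈-tuples⁻ (filter P? xs) k v∈

vertexTuples : ∀ n k → List (Vec (Fin n) k)
vertexTuples n = tuples (allFin n)

vertexTuples-unique : ∀ n k → Uniqueˡ (vertexTuples n k)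
vertexTuples-unique n k = tuples-unique k (Uniqueˡ.allFin⁺ n)

∈-vertexTuples : ∀ {n k} (v : Vec (Fin n) k) → v ∈ˡ vertexTuples n k
∈-vertexTuples v = ∈-tuples⁺ (All.universal ∈ˡ.∈-allFin v)

length-vertexTuples : ∀ n k → length (vertexTuples n k) ≡ n ^ k
length-vertexTuples n k = trans (length-tuples (allFin n) k) (cong (_^ k) (length-allFin n))

module Counting {n q} (T : List (Vec (Fin n) (3 + q))) (T! : Uniqueˡ T) where
  open ≤-Reasoning

  r M : ℕ
  r = 3 + q
  M = length T

  -- In the notation of the opening comment, `codegree` is d and `nbrs y` is D(y); below,
  -- `headCodegree` is d(x, v) and `Star S y` says that S ⊆ D(y).
  codegree : Fin n → Fin n → ℕ
  codegree a b = ∑[ τ ← T ] (𝟙 (a ∈? τ) * 𝟙 (b ∈? τ))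

  nbrs : Vec (Fin n) (2 + q) → List (Fin n)
  nbrs y = filter (λ w → (w ∷ y) ∈ˡ? T) (allFin n)

  degree : Vec (Fin n) (2 + q) → ℕ
  degree y = length (nbrs y)

  headCodegree : Vec (Fin n) (2 + q) → ℕ
  headCodegree (x ∷ v ∷ _) = codegree x v

  Star : ∀ {s} → Vec (Fin n) s → Vec (Fin n) (2 + q) → Set
  Star S y = All (λ w → (w ∷ y) ∈ˡ T) S

  star? : ∀ {s} (S : Vec (Fin n) s) y → Dec (Star S y)
  star? S y = all? (λ w → (w ∷ y) ∈ˡ? T) S

  codegree≤M : ∀ a b → codegree a b ≤ M
  codegree≤M a b = ≤-trans
    (∑-mono T λ τ → *-mono-≤ (𝟙≤1 (a ∈? τ)) (𝟙≤1 (b ∈? τ))) (≤-reflexive (sym (length≡∑ T)))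

  -- Double counting: an edge is counted once for each ordered pair of its vertices, and there are
  -- at most `r * r` of these.
  ∑-codegree : ∑[ a ← allFin n ] ∑[ b ← allFin n ] codegree a b ≤ M * (r * r)
  ∑-codegree = begin
    ∑[ a ← allFin n ] ∑[ b ← allFin n ] codegree a b
      ≡⟨ ∑-cong (allFin n) (λ a → ∑-swap (allFin n) T (λ b τ → 𝟙 (a ∈? τ) * 𝟙 (b ∈? τ))) ⟩
    ∑[ a ← allFin n ] ∑[ τ ← T ] ∑[ b ← allFin n ] (𝟙 (a ∈? τ) * 𝟙 (b ∈? τ))
      ≡⟨ ∑-swap (allFin n) T _ ⟩
    ∑[ τ ← T ] ∑[ a ← allFin n ] ∑[ b ← allFin n ] (𝟙 (a ∈? τ) * 𝟙 (b ∈? τ))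
      ≤⟨ ∑-mono T (λ τ → begin
           ∑[ a ← allFin n ] ∑[ b ← allFin n ] (𝟙 (a ∈? τ) * 𝟙 (b ∈? τ))
             ≡⟨ ∑-cong (allFin n) (λ a → ∑-*ˡ (allFin n) (𝟙 (a ∈? τ)) (λ b → 𝟙 (b ∈? τ))) ⟩
           ∑[ a ← allFin n ] (𝟙 (a ∈? τ) * ∑[ b ← allFin n ] 𝟙 (b ∈? τ))
             ≡⟨ ∑-*ʳ (allFin n) (λ a → 𝟙 (a ∈? τ)) _ ⟩
           ∑[ a ← allFin n ] 𝟙 (a ∈? τ) * ∑[ b ← allFin n ] 𝟙 (b ∈? τ)
             ≤⟨ *-mono-≤ (∑-𝟙∈≤ τ) (∑-𝟙∈≤ τ) ⟩
           r * r ∎) ⟩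
    ∑[ _ ← T ] (r * r)
      ≡⟨ ∑-const T (r * r) ⟩
    M * (r * r) ∎

  -- The summand depends on the first two entries; the other `q` contribute the factor `n ^ q`.
  ∑-headCodegree : ∑ (vertexTuples n (2 + q)) headCodegree ≤ n ^ q * (M * (r * r))
  ∑-headCodegree = begin
    ∑ (vertexTuples n (2 + q)) headCodegree
      ≡⟨ ∑-tuples-suc (allFin n) (suc q) headCodegree ⟩
    ∑[ x ← allFin n ] ∑[ v ← vertexTuples n (suc q) ] headCodegree (x ∷ v)
      ≡⟨ ∑-cong (allFin n) (λ x → ∑-tuples-suc (allFin n) q (headCodegree ∘ (x ∷_))) ⟩
    ∑[ x ← allFin n ] ∑[ v ← allFin n ] ∑[ _ ← vertexTuples n q ] codegree x v
      ≡⟨ ∑-cong (allFin n) (λ x → trans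
           (∑-cong (allFin n) λ v → trans (∑-const (vertexTuples n q) (codegree x v))
             (cong (_* codegree x v) (length-vertexTuples n q)))
           (∑-*ˡ (allFin n) (n ^ q) (codegree x))) ⟩
    ∑[ x ← allFin n ] (n ^ q * ∑[ v ← allFin n ] codegree x v)
      ≡⟨ ∑-*ˡ (allFin n) (n ^ q) _ ⟩
    n ^ q * ∑[ x ← allFin n ] ∑[ v ← allFin n ] codegree x v
      ≤⟨ *-monoʳ-≤ (n ^ q) ∑-codegree ⟩
    n ^ q * (M * (r * r)) ∎

  M≤∑-degree : M ≤ ∑ (vertexTuples n (2 + q)) degree
  M≤∑-degree = begin
    M
      ≡⟨ length≡∑ T ⟩
    ∑[ _ ← T ] 1
      ≤⟨ ∑-⊆ _ T! (λ {τ} τ∈ → ∈ˡ.∈-filter⁺ (_∈ˡ? T) (∈-vertexTuples τ) τ∈) ⟩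
    ∑[ _ ← filter (_∈ˡ? T) (vertexTuples n r) ] 1
      ≡⟨ length≡∑ (filter (_∈ˡ? T) (vertexTuples n r)) ⟨
    length (filter (_∈ˡ? T) (vertexTuples n r))
      ≡⟨ length-filter≡∑ (_∈ˡ? T) (vertexTuples n r) ⟩
    ∑[ τ ← vertexTuples n r ] 𝟙 (τ ∈ˡ? T)
      ≡⟨ ∑-tuples-suc (allFin n) (2 + q) (λ τ → 𝟙 (τ ∈ˡ? T)) ⟩
    ∑[ w ← allFin n ] ∑[ y ← vertexTuples n (2 + q) ] 𝟙 ((w ∷ y) ∈ˡ? T)
      ≡⟨ ∑-swap (allFin n) (vertexTuples n (2 + q)) _ ⟩
    ∑[ y ← vertexTuples n (2 + q) ] ∑[ w ← allFin n ] 𝟙 ((w ∷ y) ∈ˡ? T)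
      ≡⟨ ∑-cong (vertexTuples n (2 + q)) (λ y → length-filter≡∑ (λ w → (w ∷ y) ∈ˡ? T) (allFin n)) ⟨
    ∑ (vertexTuples n (2 + q)) degree ∎

  -- The map `y ↦ w ∷ y` injects the counted `y` into the edges that contain both `w` and `u`.
  ∑-through≤codegree : ∀ w u →
    ∑[ y ← vertexTuples n (2 + q) ] (𝟙 ((w ∷ y) ∈ˡ? T) * 𝟙 (u ∈? y)) ≤ codegree w u
  ∑-through≤codegree w u = begin
    ∑[ y ← keys ] (𝟙 ((w ∷ y) ∈ˡ? T) * 𝟙 (u ∈? y))
      ≡⟨ ∑-filter w∷? keys (λ y → 𝟙 (u ∈? y)) ⟨
    ∑[ y ← filter w∷? keys ] 𝟙 (u ∈? y)
      ≤⟨ ∑-mono (filter w∷? keys) (λ y → 𝟙-mono (u ∈? y) λ u∈y →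
           *-mono-≤ (𝟙-yes (hereᵛ refl) (w ∈? (w ∷ y))) (𝟙-yes (thereᵛ u∈y) (u ∈? (w ∷ y)))) ⟩
    ∑[ y ← filter w∷? keys ] both (w ∷ y)
      ≡⟨ ∑-map (w ∷_) (filter w∷? keys) both ⟨
    ∑ (map (w ∷_) (filter w∷? keys)) both
      ≤⟨ ∑-⊆ both (Uniqueˡ.map⁺ ∷-injectiveʳ (Uniqueˡ.filter⁺ w∷? (vertexTuples-unique n (2 + q)))) ⊆T ⟩
    codegree w u ∎
    where
    keys = vertexTuples n (2 + q)
    both : Vec (Fin n) r → ℕ
    both τ = 𝟙 (w ∈? τ) * 𝟙 (u ∈? τ)
    w∷? : ∀ y → Dec ((w ∷ y) ∈ˡ T)
    w∷? y = (w ∷ y) ∈ˡ? T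
    ⊆T : ∀ {τ} → τ ∈ˡ map (w ∷_) (filter w∷? keys) → τ ∈ˡ T
    ⊆T τ∈ with ∈ˡ.∈-map⁻ (w ∷_) τ∈
    ... | y , y∈ , refl = proj₂ (∈ˡ.∈-filter⁻ w∷? {xs = keys} y∈)

  -- L is divisible by suc d for all d ≤ M, so that weight is 1 / (1 + d) up to the exact factor L.
  L : ℕ
  L = suc M !

  weight : ℕ → ℕ
  weight d = L / suc d

  weight-exact : ∀ {d} → d ≤ M → suc d * weight d ≡ L
  weight-exact {d} d≤M = m*[n/m]≡n (∣-trans (m∣m*n (d !)) (m≤n⇒m!∣n! (s≤s d≤M)))

  weight-antitone : ∀ {c d} → c ≤ d → weight d ≤ weight c
  weight-antitone c≤d = /-monoʳ-≤ L (s≤s c≤d)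

  -- Up to the factor `L` this is d / (1 + d) ≤ 1, which bounds the contribution of a single
  -- transversal vertex.
  weight*≤L : ∀ d → weight d * d ≤ L
  weight*≤L d = ≤-trans (*-monoʳ-≤ (weight d) (n≤1+n d)) (m/n*n≤m L (suc d))

  module _ (heavy : ∀ {w u y} → (w ∷ y) ∈ˡ T → u ∈ y → codegree w u ≤ headCodegree y) where

    -- Each counted `y` contains some `u` of `C`. By `heavy` its weight is at most
    -- `weight (codegree w u)`, and at most `codegree w u` of the `y` contain the same `u`, so each
    -- of the `K` entries of `C` costs at most `L`.
    blocked-weight≤ : ∀ {s K} (S : Vec (Fin n) (suc s)) (C : Vec (Fin n) K) →
      (∀ y → Star S y → ∃[ u ] (u ∈ C × u ∈ y)) →
      ∑[ y ← vertexTuples n (2 + q) ] (𝟙 (star? S y) * weight (headCodegree y)) ≤ K * L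
    blocked-weight≤ {K = K} S@(w ∷ _) C blocks = begin
      ∑[ y ← keys ] (𝟙 (star? S y) * weight (headCodegree y))
        ≤⟨ ∑-mono keys (λ y → 𝟙*-mono (star? S y) (pointwise y)) ⟩
      ∑[ y ← keys ] ∑[ u ← toList C ] (weight (codegree w u) * through y u)
        ≡⟨ ∑-swap keys (toList C) (λ y u → weight (codegree w u) * through y u) ⟩
      ∑[ u ← toList C ] ∑[ y ← keys ] (weight (codegree w u) * through y u)
        ≡⟨ ∑-cong (toList C) (λ u → ∑-*ˡ keys (weight (codegree w u)) (λ y → through y u)) ⟩
      ∑[ u ← toList C ] (weight (codegree w u) * ∑[ y ← keys ] through y u)
        ≤⟨ ∑-mono (toList C) (λ u → ≤-trans
             (*-monoʳ-≤ (weight (codegree w u)) (∑-through≤codegree w u))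
             (weight*≤L (codegree w u))) ⟩
      ∑[ _ ← toList C ] L
        ≡⟨ trans (∑-const (toList C) L) (cong (_* L) (length-toList C)) ⟩
      K * L ∎
      where
      keys = vertexTuples n (2 + q)
      through : Vec (Fin n) (2 + q) → Fin n → ℕ
      through y u = 𝟙 ((w ∷ y) ∈ˡ? T) * 𝟙 (u ∈? y)
      pointwise : ∀ y → Star S y →
        weight (headCodegree y) ≤ ∑[ u ← toList C ] (weight (codegree w u) * through y u)
      pointwise y star@(w∷y∈T ∷ _) with blocks y star
      ... | u , u∈C , u∈y = begin
        weight (headCodegree y)
          ≤⟨ weight-antitone (heavy w∷y∈T u∈y) ⟩
        weight (codegree w u)
          ≡⟨ *-identityʳ _ ⟨
        weight (codegree w u) * 1
          ≤⟨ *-monoʳ-≤ (weight (codegree w u))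
               (*-mono-≤ (𝟙-yes w∷y∈T ((w ∷ y) ∈ˡ? T)) (𝟙-yes u∈y (u ∈? y))) ⟩
        weight (codegree w u) * through y u
          ≤⟨ f∈≤∑ (λ u → weight (codegree w u) * through y u) (∈-toList⁺ u∈C) ⟩
        ∑[ u ← toList C ] (weight (codegree w u) * through y u) ∎


    module _ {s K} {Bad : Vec (Fin n) (suc s) → Set} (Bad? : Decidable Bad)
      (block : ∀ {S} → Bad S → Σ[ C ∈ Vec (Fin n) K ] (∀ y → Star S y → ∃[ u ] (u ∈ C × u ∈ y)))
      where

      #bad : Vec (Fin n) (2 + q) → ℕ
      #bad y = ∑[ S ← tuples (nbrs y) (suc s) ] 𝟙 (Bad? S)

      -- Double counting of the pairs (S, y) with S a bad tuple from `nbrs y`: after exchanging the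
      -- sums, each of the `n ^ suc s` tuples S costs at most `K * L` by `blocked-weight≤`.
      ∑-weight*#bad : ∑[ y ← vertexTuples n (2 + q) ] (weight (headCodegree y) * #bad y) ≤
        n ^ suc s * (K * L)
      ∑-weight*#bad = begin
        ∑[ y ← keys ] (weight (headCodegree y) * #bad y)
          ≤⟨ ∑-mono keys (λ y → *-monoʳ-≤ (weight (headCodegree y))
               (∑-tuples-filter (λ w → (w ∷ y) ∈ˡ? T) (Uniqueˡ.allFin⁺ n) (suc s) (𝟙 ∘ Bad?))) ⟩
        ∑[ y ← keys ] (weight (headCodegree y) * ∑[ S ← tups ] (𝟙 (star? S y) * 𝟙 (Bad? S)))
          ≡⟨ ∑-cong keys (λ y → trans (sym (∑-*ˡ tups (weight (headCodegree y)) _))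
               (∑-cong tups λ S → rotate (weight (headCodegree y)) (𝟙 (star? S y)) (𝟙 (Bad? S)))) ⟩
        ∑[ y ← keys ] ∑[ S ← tups ] (𝟙 (Bad? S) * (𝟙 (star? S y) * weight (headCodegree y)))
          ≡⟨ ∑-swap keys tups _ ⟩
        ∑[ S ← tups ] ∑[ y ← keys ] (𝟙 (Bad? S) * (𝟙 (star? S y) * weight (headCodegree y)))
          ≡⟨ ∑-cong tups (λ S → ∑-*ˡ keys (𝟙 (Bad? S)) _) ⟩
        ∑[ S ← tups ] (𝟙 (Bad? S) * ∑[ y ← keys ] (𝟙 (star? S y) * weight (headCodegree y)))
          ≤⟨ ∑-mono tups (λ S → 𝟙*-mono (Bad? S) λ b →
               blocked-weight≤ S (proj₁ (block b)) (proj₂ (block b))) ⟩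
        ∑[ _ ← tups ] (K * L)
          ≡⟨ trans (∑-const tups (K * L)) (cong (_* (K * L)) (length-vertexTuples n (suc s))) ⟩
        n ^ suc s * (K * L) ∎
        where
        keys = vertexTuples n (2 + q)
        tups = vertexTuples n (suc s)
        rotate : ∀ a b c → a * (b * c) ≡ c * (b * a)
        rotate = solve-∀

  -- With this factor, the `y` outside `Good` account for at most half of the edges; `2 + r * r`
  -- collects the terms of `∑-waste`.
  c₂ : ℕ
  c₂ = 2 * (2 + r * r)

  module _ (1≤n : 1 ≤ n) {θ} (1≤θ : 1 ≤ θ) (M-large : θ * (c₂ * (n ^ q * (n * n))) ≤ M) where

    private
      Q R : ℕ
      Q = c₂ * n ^ q
      R = c₂ * (n ^ q * (n * n))
      keys = vertexTuples n (2 + q)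

    -- Two lower bounds on the degree, (1 + d(x, v)) / `Q` and `M` / `R`, where `Q` is of order n^(r
    -- - 3) and `R` of order n^(r - 1).
    Good : Vec (Fin n) (2 + q) → Set
    Good y = suc (headCodegree y) ≤ Q * degree y × M ≤ R * degree y

    good? : ∀ y → Dec (Good y)
    good? y = (suc (headCodegree y) ≤? Q * degree y) ×-dec (M ≤? R * degree y)

    goodDegree : Vec (Fin n) (2 + q) → ℕ
    goodDegree y = 𝟙 (good? y) * degree y

    -- A bound for `R * degree y` when `Good y` fails: failure of the first inequality gives the
    -- first summand, since `R` equals `Q * (n * n)`, and failure of the second gives `M`.
    waste : Vec (Fin n) (2 + q) → ℕ
    waste y = suc (headCodegree y) * (n * n) + M

    instance
      n≢0 : NonZero n
      n≢0 = >-nonZero 1≤n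
      R≢0 : NonZero R
      R≢0 = m*n≢0 c₂ _ {{_}} {{m*n≢0 (n ^ q) (n * n) {{m^n≢0 n q}} {{m*n≢0 n n}}}}

    R≤M : R ≤ M
    R≤M = ≤-trans (≤-trans (≤-reflexive (sym (*-identityˡ R))) (*-monoˡ-≤ R 1≤θ)) M-large

    n²≤M : n * n ≤ M
    n²≤M = ≤-trans (≤-trans (m≤n*m (n * n) (n ^ q) {{m^n≢0 n q}}) (m≤n*m _ c₂)) R≤M

    degree≤good+waste : ∀ y →
      R * degree y ≤ R * goodDegree y + waste y
    degree≤good+waste y with suc (headCodegree y) ≤? Q * degree y | M ≤? R * degree y
    ... | yes _   | yes _   = ≤-trans
      (*-monoʳ-≤ R (≤-reflexive (sym (+-identityʳ (degree y))))) (m≤m+n _ _)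
    ... | no light | _      = begin
      R * degree y                         ≡⟨ regroup c₂ (n ^ q) (n * n) (degree y) ⟩
      Q * degree y * (n * n)               ≤⟨ *-monoˡ-≤ (n * n) (<⇒≤ (≰⇒> light)) ⟩
      suc (headCodegree y) * (n * n)       ≤⟨ m≤m+n _ M ⟩
      suc (headCodegree y) * (n * n) + M   ≤⟨ m≤n+m _ (R * _) ⟩
      R * _ + waste y ∎
      where
      regroup : ∀ a b c d → a * (b * c) * d ≡ a * b * d * c
      regroup = solve-∀
    ... | yes _   | no small = begin
      R * degree y                         ≤⟨ <⇒≤ (≰⇒> small) ⟩
      M                                    ≤⟨ m≤n+m M _ ⟩
      suc (headCodegree y) * (n * n) + M   ≤⟨ m≤n+m _ (R * _) ⟩
      R * _ + waste y ∎

    ∑-waste : 2 * ∑ keys waste ≤ R * M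
    ∑-waste = begin
      2 * ∑ keys waste
        ≡⟨ cong (2 *_) (trans (∑-+ keys (λ y → suc (headCodegree y) * (n * n)) (λ _ → M))
             (cong₂ _+_ (trans (∑-*ʳ keys (suc ∘ headCodegree) (n * n))
                (cong (_* (n * n)) (trans (∑-+ keys (λ _ → 1) headCodegree)
                  (cong (_+ ∑ keys headCodegree) (sym (length≡∑ keys))))))
                (∑-const keys M))) ⟩
      2 * ((length keys + ∑ keys headCodegree) * (n * n) + length keys * M)
        ≤⟨ *-monoʳ-≤ 2 (+-monoˡ-≤ _ (*-monoˡ-≤ (n * n)
             (+-monoʳ-≤ (length keys) ∑-headCodegree))) ⟩
      2 * ((length keys + n ^ q * (M * (r * r))) * (n * n) + length keys * M)
        ≡⟨ cong (λ l → 2 * ((l + n ^ q * (M * (r * r))) * (n * n) + l * M))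
             (length-vertexTuples n (2 + q)) ⟩
      2 * ((n ^ (2 + q) + n ^ q * (M * (r * r))) * (n * n) + n ^ (2 + q) * M)
        ≡⟨ expand n (n ^ q) M (r * r) ⟩
      2 * ((n ^ q * (n * n)) * (n * n) + (n ^ q * (n * n)) * (M * (1 + r * r)))
        -- The term from the 1 in `suc (headCodegree y)` is absorbed by `n * n ≤ M`.
        ≤⟨ *-monoʳ-≤ 2 (+-monoˡ-≤ _ (*-monoʳ-≤ (n ^ q * (n * n)) n²≤M)) ⟩
      2 * ((n ^ q * (n * n)) * M + (n ^ q * (n * n)) * (M * (1 + r * r)))
        ≡⟨ collect (n ^ q * (n * n)) M (r * r) ⟩
      R * M ∎
      where
      expand : ∀ n N M ρ → 2 * ((n * (n * N) + N * (M * ρ)) * (n * n) + n * (n * N) * M) ≡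
        2 * ((N * (n * n)) * (n * n) + (N * (n * n)) * (M * (1 + ρ)))
      expand = solve-∀
      collect : ∀ k M ρ → 2 * (k * M + k * (M * (1 + ρ))) ≡ 2 * (2 + ρ) * k * M
      collect = solve-∀

    -- `M≤∑-degree` is used twice; the waste takes up one of the two copies of `R * M`, which is
    -- then cancelled.
    M≤2*∑-goodDegree : M ≤ 2 * ∑ keys goodDegree
    M≤2*∑-goodDegree = *-cancelˡ-≤ R (+-cancelʳ-≤ (R * M) _ _ (begin
      R * M + R * M
        ≤⟨ +-mono-≤ R*M≤ R*M≤ ⟩
      R * ∑ keys degree + R * ∑ keys degree
        ≡⟨ twice (R * ∑ keys degree) ⟩
      2 * (R * ∑ keys degree)
        ≡⟨ cong (2 *_) (∑-*ˡ keys R degree) ⟨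
      2 * ∑[ y ← keys ] (R * degree y)
        ≤⟨ *-monoʳ-≤ 2 (∑-mono keys degree≤good+waste) ⟩
      2 * ∑[ y ← keys ] (R * goodDegree y + waste y)
        ≡⟨ cong (2 *_) (trans (∑-+ keys (λ y → R * goodDegree y) waste)
             (cong (_+ ∑ keys waste) (∑-*ˡ keys R goodDegree))) ⟩
      2 * (R * ∑ keys goodDegree + ∑ keys waste)
        ≡⟨ distrib R (∑ keys goodDegree) _ ⟩
      R * (2 * ∑ keys goodDegree) + 2 * ∑ keys waste
        ≤⟨ +-monoʳ-≤ _ ∑-waste ⟩
      R * (2 * ∑ keys goodDegree) + R * M ∎))
      where
      R*M≤ = *-monoʳ-≤ R M≤∑-degree
      twice : ∀ a → a + a ≡ 2 * a
      twice = solve-∀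
      distrib : ∀ a b c → 2 * (a * b + c) ≡ a * (2 * b) + 2 * c
      distrib = solve-∀

    module _ {s c₁} (#bad : Vec (Fin n) (2 + q) → ℕ)
      (many : ∀ y → θ ≤ degree y → degree y ^ (2 + s) ≤ c₁ * #bad y) where

      -- For a good `y` of degree D, the inequalities of `Good` bound `L` by Q D ω and `M ^ s` by (R
      -- D)^s. This raises D to the power 2 + s, which `many` converts into bad tuples.
      goodDegree≤ : ∀ y → goodDegree y * (L * M ^ s) ≤
        c₁ * (Q * R ^ s) * (weight (headCodegree y) * #bad y)
      goodDegree≤ y = ≤-trans (≤-reflexive (*-assoc (𝟙 (good? y)) (degree y) _))
        (𝟙*-mono (good? y) λ (light , M≤) → begin
          D * (L * M ^ s)
            ≤⟨ *-monoʳ-≤ D (*-mono-≤ (L≤ y light) (^-monoˡ-≤ s M≤)) ⟩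
          D * (Q * D * ω * (R * D) ^ s)
            ≡⟨ cong (λ p → D * (Q * D * ω * p)) (^-distribʳ-* s R D) ⟩
          D * (Q * D * ω * (R ^ s * D ^ s))
            ≡⟨ regroup D Q ω (R ^ s) (D ^ s) ⟩
          Q * R ^ s * ω * D ^ (2 + s)
            ≤⟨ *-monoʳ-≤ (Q * R ^ s * ω) (many y (θ≤ M≤)) ⟩
          Q * R ^ s * ω * (c₁ * #bad y)
            ≡⟨ regroup₂ (Q * R ^ s) ω c₁ (#bad y) ⟩
          c₁ * (Q * R ^ s) * (ω * #bad y) ∎)
        where
        D = degree y
        ω = weight (headCodegree y)
        L≤ : ∀ y → suc (headCodegree y) ≤ Q * degree y → L ≤ Q * degree y * weight (headCodegree y)
        L≤ y@(a ∷ b ∷ _) light = ≤-trans (≤-reflexive (sym (weight-exact (codegree≤M a b))))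
          (*-monoˡ-≤ (weight (headCodegree y)) light)
        -- `M-large` reads θ R ≤ M, so M ≤ R D forces θ ≤ D and `many` applies.
        θ≤ : M ≤ R * degree y → θ ≤ D
        θ≤ M≤ = *-cancelʳ-≤ θ D R (≤-trans M-large (≤-trans M≤ (≤-reflexive (*-comm R D))))
        regroup : ∀ D Q ω P E → D * (Q * D * ω * (P * E)) ≡ Q * P * ω * (D * (D * E))
        regroup = solve-∀
        regroup₂ : ∀ a ω c b → a * ω * (c * b) ≡ c * a * (ω * b)
        regroup₂ = solve-∀

      -- `M≤2*∑-goodDegree` is multiplied by `L * M ^ s`, so that `goodDegree≤` and the upper bound
      -- on the weighted count apply; then `L` cancels. Here `s` is the s of the theorem minus 2,
      -- and the exponent of `n` is r (1 + s) - 1.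
      M^≤ : ∀ {K} → ∑[ y ← keys ] (weight (headCodegree y) * #bad y) ≤ n ^ (2 + s) * (K * L) →
        M ^ (1 + s) ≤ 2 * c₁ * K * c₂ ^ (1 + s) * n ^ (2 + q + s * (3 + q))
      M^≤ {K} ∑≤ = *-cancelˡ-≤ L {{(suc M) !≢0}} (begin
        L * (M * M ^ s)
          ≡⟨ rotate L M (M ^ s) ⟩
        M * (L * M ^ s)
          ≤⟨ *-monoˡ-≤ (L * M ^ s) M≤2*∑-goodDegree ⟩
        2 * ∑ keys goodDegree * (L * M ^ s)
          ≡⟨ trans (*-assoc 2 (∑ keys goodDegree) _)
               (cong (2 *_) (sym (∑-*ʳ keys goodDegree (L * M ^ s)))) ⟩
        2 * ∑[ y ← keys ] (goodDegree y * (L * M ^ s))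
          ≤⟨ *-monoʳ-≤ 2 (∑-mono keys goodDegree≤) ⟩
        2 * ∑[ y ← keys ] (c₁ * (Q * R ^ s) * (weight (headCodegree y) * #bad y))
          ≡⟨ cong (2 *_) (∑-*ˡ keys (c₁ * (Q * R ^ s)) _) ⟩
        2 * (c₁ * (Q * R ^ s) * ∑[ y ← keys ] (weight (headCodegree y) * #bad y))
          ≤⟨ *-monoʳ-≤ 2 (*-monoʳ-≤ (c₁ * (Q * R ^ s)) ∑≤) ⟩
        2 * (c₁ * (Q * R ^ s) * (n ^ (2 + s) * (K * L)))
          ≡⟨ cong (λ p → 2 * (c₁ * (Q * p) * (n ^ (2 + s) * (K * L)))) R^s ⟩
        2 * (c₁ * (c₂ * n ^ q * (c₂ ^ s * n ^ (s * (2 + q)))) * (n ^ (2 + s) * (K * L)))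
          ≡⟨ collect c₁ c₂ (n ^ q) (c₂ ^ s) (n ^ (s * (2 + q))) (n ^ (2 + s)) K L ⟩
        L * (2 * c₁ * K * c₂ ^ (1 + s) * (n ^ q * n ^ (s * (2 + q)) * n ^ (2 + s)))
          ≡⟨ cong (λ p → L * (2 * c₁ * K * c₂ ^ (1 + s) * p)) n^ ⟩
        L * (2 * c₁ * K * c₂ ^ (1 + s) * n ^ (2 + q + s * (3 + q))) ∎)
        where
        rotate : ∀ a b c → a * (b * c) ≡ b * (a * c)
        rotate = solve-∀
        collect : ∀ c₁ c₂ N e P S K L → 2 * (c₁ * (c₂ * N * (e * P)) * (S * (K * L))) ≡
          L * (2 * c₁ * K * (c₂ * e) * (N * P * S))
        collect = solve-∀
        exponent : ∀ q s → q + s * (2 + q) + (2 + s) ≡ 2 + q + s * (3 + q)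
        exponent = solve-∀
        R^s : R ^ s ≡ c₂ ^ s * n ^ (s * (2 + q))
        R^s = trans (^-distribʳ-* s c₂ _) (cong (c₂ ^ s *_)
          (trans (cong (_^ s) (n^q*n² n (n ^ q)))
            (trans (^-*-assoc n (2 + q) s) (cong (n ^_) (*-comm (2 + q) s)))))
          where
          n^q*n² : ∀ n N → N * (n * n) ≡ n * (n * N)
          n^q*n² = solve-∀
        n^ : n ^ q * n ^ (s * (2 + q)) * n ^ (2 + s) ≡ n ^ (2 + q + s * (3 + q))
        n^ = trans (cong (_* n ^ (2 + s)) (sym (^-distribˡ-+-* n q (s * (2 + q)))))
          (trans (sym (^-distribˡ-+-* n (q + s * (2 + q)) (2 + s))) (cong (n ^_) (exponent q s)))

-- Edges as tuples

elements : Subset n → List (Fin n)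
elements []            = []
elements (inside  ∷ p) = zero ∷ map suc (elements p)
elements (outside ∷ p) = map suc (elements p)

length-elements : (p : Subset n) → length (elements p) ≡ ∣ p ∣
length-elements []            = refl
length-elements (inside  ∷ p) = cong suc (trans (length-map suc (elements p)) (length-elements p))
length-elements (outside ∷ p) = trans (length-map suc (elements p)) (length-elements p)

∈-elements⁺ : ∀ {p : Subset n} {v} → v ∈ˢ p → v ∈ˡ elements p
∈-elements⁺ {p = inside ∷ p}  here        = here refl
∈-elements⁺ {p = inside ∷ p}  (there v∈p) = there (∈ˡ.∈-map⁺ suc (∈-elements⁺ v∈p))
∈-elements⁺ {p = outside ∷ p} (there v∈p) = ∈ˡ.∈-map⁺ suc (∈-elements⁺ v∈p)

∈-elements⁻ : ∀ (p : Subset n) {v} → v ∈ˡ elements p → v ∈ˢ p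
∈-elements⁻ (inside ∷ p)  (here refl) = here
∈-elements⁻ (inside ∷ p)  (there v∈) with ∈ˡ.∈-map⁻ suc v∈
... | _ , u∈ , refl = there (∈-elements⁻ p u∈)
∈-elements⁻ (outside ∷ p) v∈ with ∈ˡ.∈-map⁻ suc v∈
... | _ , u∈ , refl = there (∈-elements⁻ p u∈)

elements-unique : (p : Subset n) → Uniqueˡ (elements p)
elements-unique []            = []
elements-unique (inside ∷ p)  = Allˡ.map⁺ (Allˡ.universal (λ _ ()) _) ∷
                                Uniqueˡ.map⁺ Fin.suc-injective (elements-unique p)
elements-unique (outside ∷ p) = Uniqueˡ.map⁺ Fin.suc-injective (elements-unique p)

Unique-fromList : ∀ {xs : List A} → Uniqueˡ xs → Unique (fromList xs)
Unique-fromList []         = AllPairs.[]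
Unique-fromList (px ∷ xs!) = All.fromList⁺ px AllPairs.∷ Unique-fromList xs!

Unique-resp-↭ : ∀ {xs ys : List A} → xs ↭ ys → Uniqueˡ xs → Uniqueˡ ys
Unique-resp-↭ xs↭ys = ↭ₛ.Unique-resp-↭ (setoid _) (↭⇒↭ₛ xs↭ys)

∈⇒↭∷ : ∀ {x : A} {xs} → x ∈ˡ xs → ∃[ xs′ ] xs ↭ x ∷ xs′
∈⇒↭∷ {x = x} x∈ with ∈ˡ.∈-∃++ x∈
... | as , bs , refl = as ++ˡ bs , shift x as bs

∈-∷⁻ : ∀ {x y : A} {xs} → x ≢ y → x ∈ˡ y ∷ xs → x ∈ˡ xs
∈-∷⁻ x≢y (here x≡y)  = contradiction x≡y x≢y
∈-∷⁻ x≢y (there x∈)  = x∈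

-- `τ` lists `e` as w ∷ x ∷ v ∷ z. The field `heaviest` keeps the maximality of d(x, v) in the form
-- that the weighted count uses, against the pairs {w, u}.
record Orders {q} (d : Fin n → Fin n → ℕ) (e : Subset n) (τ : Vec (Fin n) (3 + q)) : Set where
  field
    distinct : Unique τ
    members  : ∀ v → v ∈ˢ e ⇔ v ∈ τ
    heaviest : ∀ {u} → u ∈ tail τ → d (head τ) u ≤ d (head (tail τ)) (head (tail (tail τ)))

open Orders

module _ (d : Fin n → Fin n → ℕ) where

  heaviest-pair : ∀ {a b l} → Uniqueˡ (a ∷ b ∷ l) →
    ∃[ x ] ∃[ v ] (x ∈ˡ a ∷ b ∷ l × v ∈ˡ a ∷ b ∷ l × x ≢ v ×
      (∀ {w u} → w ∈ˡ a ∷ b ∷ l → u ∈ˡ a ∷ b ∷ l → w ≢ u → d w u ≤ d x v))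
  heaviest-pair {a} {b} {l} (a∉ ∷ _) = x , v , proj₁ xv∈ , proj₁ (proj₂ xv∈) , proj₂ (proj₂ xv∈) ,
    λ w∈ u∈ w≢u → Allˡ.lookup (f[xs]≤f[argmax] (a , b) pairs)
      (∈ˡ.∈-filter⁺ distinct? (∈ˡ.∈-cartesianProduct⁺ w∈ u∈) w≢u)
    where
    L = a ∷ b ∷ l
    d′ : Fin n × Fin n → ℕ
    d′ (w , u) = d w u
    distinct? : ∀ (wu : Fin n × Fin n) → Dec (proj₁ wu ≢ proj₂ wu)
    distinct? (w , u) = ¬? (w Fin.≟ u)
    pairs = filter distinct? (cartesianProduct L L)
    -- The default `(a , b)` is itself a pair of distinct elements, so the maximum is always
    -- attained at such a pair.
    xv = argmax d′ (a , b) pairs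
    x = proj₁ xv
    v = proj₂ xv
    IsPair : Fin n × Fin n → Set
    IsPair (w , u) = w ∈ˡ L × u ∈ˡ L × w ≢ u
    pairs⊆ : ∀ {wu} → wu ∈ˡ pairs → IsPair wu
    pairs⊆ wu∈ with ∈ˡ.∈-filter⁻ distinct? {xs = cartesianProduct L L} wu∈
    ... | wu∈L×L , w≢u with ∈ˡ.∈-cartesianProduct⁻ L L wu∈L×L
    ... | w∈ , u∈ = w∈ , u∈ , w≢u
    xv∈ : IsPair xv
    xv∈ = argmax-all d′ {P = IsPair} (here refl , there (here refl) , Allˡ.head a∉)
            (Allˡ.tabulate pairs⊆)

  -- The heaviest pair x, v is taken out of the list of elements; a further element w, which exists
  -- as there are at least three, is moved to the head.
  ordering : ∀ q {e} → ∣ e ∣ ≡ 3 + q → ∃[ τ ] Orders {q = q} d e τ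
  ordering q {e} ∣e∣≡ with elements e | elements-unique e | trans (length-elements e) ∣e∣≡
                         | (λ {v} → ∈-elements⁺ {p = e} {v}) | (λ {v} → ∈-elements⁻ e {v})
  ... | L@(a ∷ b ∷ l) | L! | ∣L∣≡ | ∈⁺ | ∈⁻ with heaviest-pair L!
  ... | x , v , x∈ , v∈ , x≢v , max with ∈⇒↭∷ x∈
  ... | L₁ , L↭₁ with ∈⇒↭∷ (∈-∷⁻ (x≢v ∘ sym) (∈-resp-↭ L↭₁ v∈))
  ... | L₂ , L↭₂ with L₂ | ↭-trans L↭₁ (prep x L↭₂)
  ... | []    | L↭ with () ← trans (sym ∣L∣≡) (↭-length L↭)
  ... | w ∷ z | L↭ with refl ← suc-injective (suc-injective (suc-injective (trans (sym ∣L∣≡) (↭-length L↭))))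
    = w ∷ x ∷ v ∷ fromList z , record
    { distinct = Unique-fromList τ!
    ; members  = λ u → mk⇔ (∈-fromList⁺ ∘ ∈-resp-↭ L↭τ ∘ ∈⁺) (∈⁻ ∘ ∈-resp-↭ (↭-sym L↭τ) ∘ ∈-fromList⁻)
    ; heaviest = λ u∈ → let u∈ˡ = ∈-fromList⁻ {xs = x ∷ v ∷ z} u∈ in
        max (∈-resp-↭ (↭-sym L↭τ) (here refl)) (∈-resp-↭ (↭-sym L↭τ) (there u∈ˡ))
          (Allˡ.lookup (Uniqueˡ-head τ!) u∈ˡ)
    }
    where
    L↭τ : L ↭ w ∷ x ∷ v ∷ z
    L↭τ = ↭-trans L↭ (shift w (x ∷ v ∷ []) z)
    τ! = Unique-resp-↭ L↭τ L!
    Uniqueˡ-head : ∀ {y : Fin n} {ys} → Uniqueˡ (y ∷ ys) → Allˡ (y ≢_) ys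
    Uniqueˡ-head (py ∷ _) = py

  orderings : ∀ q {es} → Allˡ (λ e → ∣ e ∣ ≡ 3 + q) es → ∃[ T ] Pointwise (Orders {q = q} d) es T
  orderings q Allˡ.[]         = [] , []
  orderings q (eq Allˡ.∷ eqs) = _ ∷ _ , proj₂ (ordering q eq) ∷ proj₂ (orderings q eqs)

  Orders-injective : ∀ {q e e′} {τ : Vec (Fin n) (3 + q)} → Orders d e τ → Orders d e′ τ → e ≡ e′
  Orders-injective o o′ = ⊆-antisym (from (members o′ _) ∘ to (members o _))
                                    (from (members o _) ∘ to (members o′ _))

  orderings-∈ : ∀ {q es T} → Pointwise (Orders {q = q} d) es T → ∀ {τ} → τ ∈ˡ T →
    ∃[ e ] (e ∈ˡ es × Orders d e τ)
  orderings-∈ (o ∷ os) (here refl) = _ , here refl , o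
  orderings-∈ (o ∷ os) (there τ∈) with orderings-∈ os τ∈
  ... | e , e∈ , o′ = e , there e∈ , o′

  orderings-unique : ∀ {q es T} → Pointwise (Orders {q = q} d) es T → Uniqueˡ es → Uniqueˡ T
  orderings-unique []       _           = []
  orderings-unique (o ∷ os) (e∉ ∷ es!) = Allˡ.tabulate fresh ∷ orderings-unique os es!
    where
    fresh : ∀ {τ′} → τ′ ∈ˡ _ → _ ≢ τ′
    fresh τ′∈ refl with orderings-∈ os τ′∈
    ... | e′ , e′∈ , o′ = Allˡ.lookup e∉ e′∈ (Orders-injective o o′)

-- Codegrees taken from the edges themselves, because the orderings are chosen by them before `T`
-- exists; `pairDegree≡codegree` identifies the two.
pairDegree : List (Subset n) → Fin n → Fin n → ℕ
pairDegree es a b = ∑[ e ← es ] (𝟙 (a ∈ˢ? e) * 𝟙 (b ∈ˢ? e))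

𝟙-⇔ : ∀ {P Q : Set} → P ⇔ Q → (P? : Dec P) (Q? : Dec Q) → 𝟙 P? ≡ 𝟙 Q?
𝟙-⇔ P⇔Q P? Q? = ≤-antisym (𝟙-mono P? λ p → 𝟙-yes (to P⇔Q p) Q?)
                          (𝟙-mono Q? λ q → 𝟙-yes (from P⇔Q q) P?)

pairDegree≡codegree : ∀ {q d es} {T : List (Vec (Fin n) (3 + q))} (T! : Uniqueˡ T) →
  Pointwise (Orders d) es T → ∀ a b → pairDegree es a b ≡ Counting.codegree T T! a b
pairDegree≡codegree _ []             a b = refl
pairDegree≡codegree {es = e ∷ _} {τ ∷ _} (_ ∷ T!) (o ∷ os) a b = cong₂ _+_
  (cong₂ _*_ (𝟙-⇔ (members o a) (a ∈ˢ? e) (a ∈? τ)) (𝟙-⇔ (members o b) (b ∈ˢ? e) (b ∈? τ)))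
  (pairDegree≡codegree T! os a b)

-- Blocked tuples


-- The elements of p, completed to exactly s by elements outside Fin k.
module _ {k s} (p : Subset k) (∣p∣≤s : ∣ p ∣ ≤ s) where

  private
    l = elements p
    ∣l∣≤s : length l ≤ s
    ∣l∣≤s = ≤-trans (≤-reflexive (length-elements p)) ∣p∣≤s

  completion : Fin s → Fin (s + k)
  completion i with toℕ i <? length l
  ... | yes i< = s ↑ʳ lookup (fromList l) (fromℕ< i<)
  ... | no _   = i ↑ˡ k

  private
    ↑ʳ≢↑ˡ : ∀ x i → s ↑ʳ x ≢ i ↑ˡ k
    ↑ʳ≢↑ˡ x i eq with () ← trans (sym (Fin.splitAt-↑ʳ s k x)) (trans (cong (splitAt s) eq) (Fin.splitAt-↑ˡ s i k))

  completion-injective : Injective _≡_ _≡_ completion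
  completion-injective {i} {j} eq with toℕ i <? length l | toℕ j <? length l
  ... | yes i< | yes j< = Fin.toℕ-injective (Fin.fromℕ<-injective _ _ i< j<
          (lookup-injective (Unique-fromList (elements-unique p)) _ _ (Fin.↑ʳ-injective s _ _ eq)))
  ... | yes i< | no _   = contradiction eq (↑ʳ≢↑ˡ _ j)
  ... | no _   | yes j< = contradiction (sym eq) (↑ʳ≢↑ˡ _ i)
  ... | no _   | no _   = Fin.↑ˡ-injective k i j eq

  completion-covers : ∀ {x} → x ∈ˢ p → ∃[ i ] completion i ≡ s ↑ʳ x
  completion-covers {x} x∈p = i , i↦x
    where
    x∈l = ∈-fromList⁺ (∈-elements⁺ x∈p)
    j = index x∈l
    i = inject≤ j ∣l∣≤s
    toℕ-i : toℕ i ≡ toℕ j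
    toℕ-i = Fin.toℕ-inject≤ j ∣l∣≤s
    i↦x : completion i ≡ s ↑ʳ x
    i↦x with toℕ i <? length l
    ... | yes i< = cong (s ↑ʳ_) (trans
            (cong (lookup (fromList l)) (Fin.toℕ-injective (trans (Fin.toℕ-fromℕ< i<) toℕ-i)))
            (sym (lookup-index x∈l)))
    ... | no i≮  = contradiction (subst (_< length l) (sym toℕ-i) (Fin.toℕ<n j)) i≮

∈-padRight : ∀ {m n} (m≤n : m ≤ n) {a v : A} {xs : Vec A m} → v ∈ xs → v ∈ padRight m≤n a xs
∈-padRight (s≤s m≤n) (hereᵛ refl)  = hereᵛ refl
∈-padRight (s≤s m≤n) (thereᵛ v∈)   = thereᵛ (∈-padRight m≤n v∈)

module _ {q} (T : List (Vec (Fin n) (3 + q))) (T! : Uniqueˡ T) (K : ℕ) where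
  open Counting T T! using (Star; star?)

  Blocks : ∀ {s} → Vec (Fin n) s → Vec (Fin n) K → Vec (Fin n) (2 + q) → Set
  Blocks S C y = Star S y → ∃[ u ] (u ∈ C × u ∈ y)

  meets? : ∀ {k l} (C : Vec (Fin n) k) (y : Vec (Fin n) l) → Dec (∃[ u ] (u ∈ C × u ∈ y))
  meets? C y = Fin.any? λ u → (u ∈? C) ×-dec (u ∈? y)

  blocks? : ∀ {s} (S : Vec (Fin n) s) C y → Dec (Blocks S C y)
  blocks? S C y = star? S y →-dec meets? C y

  -- The (r - 1)-sets completing all of S to edges have a transversal of at most K vertices.
  Blocked : ∀ {s} → Vec (Fin n) s → Set
  Blocked S = Anyˡ (λ C → Allˡ (Blocks S C) (vertexTuples n (2 + q))) (vertexTuples n K)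

  blocked? : ∀ {s} → Decidable (Blocked {s})
  blocked? S = anyˡ? (λ C → allˡ? (blocks? S C) (vertexTuples n (2 + q))) (vertexTuples n K)

  blocked⇒transversal : ∀ {s} {S : Vec (Fin n) s} → Blocked S →
    Σ[ C ∈ Vec (Fin n) K ] (∀ y → Star S y → ∃[ u ] (u ∈ C × u ∈ y))
  blocked⇒transversal b with find b
  ... | C , _ , blocks = C , λ y → Allˡ.lookup blocks (∈-vertexTuples y)

  -- Otherwise `avoid`, padded to `K` entries, would be a transversal.
  unblocked⇒star : ∀ {s} {S : Vec (Fin n) (suc s)} → ¬ Blocked S →
    ∀ (avoid : List (Fin n)) → length avoid ≤ K →
    ∃[ y ] (Star S y × (∀ {u} → u ∈ y → u ∉ˡ avoid))
  unblocked⇒star {S = S@(a ∷ _)} ¬b avoid ≤K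
    with find (Allˡ.¬All⇒Any¬ (blocks? S C) (vertexTuples n (2 + q))
                 (λ blocks → ¬b (lose (∈-vertexTuples C) blocks)))
    -- The head `a` of `S` is the filler that brings `avoid` to length exactly `K`.
    where C = padRight ≤K a (fromList avoid)
  ... | y , _ , ¬blocks with star? S y
  ... | no ¬star = contradiction (λ star → contradiction star ¬star) ¬blocks
  ... | yes star = y , star , λ u∈y u∈ → ¬blocks λ _ →
          _ , ∈-padRight ≤K (∈-fromList⁺ u∈) , u∈y

  -- Greedy choice: every chosen tuple joins `avoid`, and the budget `K` leaves room for all `m` of
  -- them.
  disjoint-stars : ∀ {s} m (S : Fin m → Vec (Fin n) (suc s)) → (∀ i → ¬ Blocked (S i)) →
    ∀ (avoid : List (Fin n)) → length avoid + m * (2 + q) ≤ K →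
    Σ[ y ∈ (Fin m → Vec (Fin n) (2 + q)) ]
      (∀ i → Star (S i) (y i)) × (∀ i {u} → u ∈ y i → u ∉ˡ avoid) ×
      (∀ {i j u} → u ∈ y i → u ∈ y j → i ≡ j)
  disjoint-stars zero    S ¬b avoid ≤K = (λ ()) , (λ ()) , (λ ()) , λ {}
  disjoint-stars (suc m) S ¬b avoid ≤K
    with unblocked⇒star (¬b zero) avoid (≤-trans (m≤m+n _ _) ≤K)
  ... | y₀ , star₀ , y₀∩avoid with disjoint-stars m (S ∘ suc) (¬b ∘ suc) (toList y₀ ++ˡ avoid)
                                    (≤-trans (≤-reflexive ∣avoid∣) ≤K)
    where
    open ≡-Reasoning
    ∣avoid∣ : length (toList y₀ ++ˡ avoid) + m * (2 + q) ≡ length avoid + suc m * (2 + q)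
    ∣avoid∣ = begin
      length (toList y₀ ++ˡ avoid) + m * (2 + q)
        ≡⟨ cong (_+ m * (2 + q)) (trans (length-++ (toList y₀))
             (trans (cong (_+ length avoid) (length-toList y₀)) (+-comm (2 + q) (length avoid)))) ⟩
      length avoid + (2 + q) + m * (2 + q)
        ≡⟨ +-assoc (length avoid) (2 + q) (m * (2 + q)) ⟩
      length avoid + suc m * (2 + q) ∎
  ... | ys , stars , ys∩avoid , disjoint = y , star , y∩avoid , y-disjoint
    where
    y : Fin (suc m) → Vec (Fin n) (2 + q)
    y zero    = y₀
    y (suc i) = ys i
    star : ∀ i → Star (S i) (y i)
    star zero    = star₀
    star (suc i) = stars i
    y∩avoid : ∀ i {u} → u ∈ y i → u ∉ˡ avoid
    y∩avoid zero    u∈ = y₀∩avoid u∈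
    y∩avoid (suc i) u∈ u∈avoid = ys∩avoid i u∈ (∈ˡ.∈-++⁺ʳ (toList y₀) u∈avoid)
    y-disjoint : ∀ {i j u} → u ∈ y i → u ∈ y j → i ≡ j
    y-disjoint {zero}  {zero}  _   _   = refl
    y-disjoint {zero}  {suc j} u∈₀ u∈  = contradiction (∈ˡ.∈-++⁺ˡ (∈-toList⁺ u∈₀)) (ys∩avoid j u∈)
    y-disjoint {suc i} {zero}  u∈  u∈₀ = contradiction (∈ˡ.∈-++⁺ˡ (∈-toList⁺ u∈₀)) (ys∩avoid i u∈)
    y-disjoint {suc i} {suc j} u∈  u∈′ = cong suc (disjoint u∈ u∈′)

-- Membership in blocks, images and concatenations

lookup-block : ∀ b k y j i → lookup (block b k y) (combine j i) ≡ inside → j ≡ y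
lookup-block b k y j i eq with j Fin.≟ y
... | yes j≡y = j≡y
... | no j≢y with () ← trans (sym eq) (trans (lookup-concat (replicate b ⊥ [ y ]≔ ⊤) j i) (trans
      (cong (λ p → lookup p i) (trans (lookup∘update′ j≢y (replicate b ⊥) ⊤) (lookup-replicate j ⊥)))
      (lookup-replicate i outside)))

combine∈block : ∀ b k y i → combine y i ∈ˢ block b k y
combine∈block b k y i = lookup⇒[]= _ _ (trans (lookup-concat (replicate b ⊥ [ y ]≔ ⊤) y i) (trans
      (cong (λ p → lookup p i) (lookup∘update y (replicate b ⊥) ⊤)) (lookup-replicate i inside)))

∈-image⁻ : ∀ {m} (f : Fin m → Fin n) p {v} → v ∈ˢ image f p → ∃[ u ] (u ∈ˢ p × f u ≡ v)
∈-image⁻ f p {v} v∈ with Fin.any? (λ u → (u ∈ˢ? p) ×-dec (f u Fin.≟ v))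
                       | trans (sym (lookup∘tabulate _ v)) ([]=⇒lookup v∈)
... | yes u | _ = u

∈-image⁺ : ∀ {m} (f : Fin m → Fin n) {p u} → u ∈ˢ p → f u ∈ˢ image f p
∈-image⁺ f {p} {u} u∈ = lookup⇒[]= (f u) _ (trans (lookup∘tabulate _ (f u)) holds)
  where
  holds : does (Fin.any? λ u′ → (u′ ∈ˢ? p) ×-dec (f u′ Fin.≟ f u)) ≡ inside
  holds with Fin.any? (λ u′ → (u′ ∈ˢ? p) ×-dec (f u′ Fin.≟ f u))
  ... | yes _ = refl
  ... | no ¬u = contradiction (u , u∈ , refl) ¬u

module _ {m k} (p : Subset m) (p′ : Subset k) where
  ∈-++⁻ : ∀ {u} → u ∈ˢ (p ++ p′) → (∃[ i ] (splitAt m u ≡ inj₁ i × i ∈ˢ p)) ⊎ (∃[ i ] (splitAt m u ≡ inj₂ i × i ∈ˢ p′))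
  ∈-++⁻ {u} u∈ with splitAt m u | trans (sym (lookup-splitAt m p p′ u)) ([]=⇒lookup u∈)
  ... | inj₁ i | eq = inj₁ (i , refl , lookup⇒[]= i p eq)
  ... | inj₂ i | eq = inj₂ (i , refl , lookup⇒[]= i p′ eq)

  ∈-++⁺ˡ : ∀ {i} → i ∈ˢ p → (i ↑ˡ k) ∈ˢ (p ++ p′)
  ∈-++⁺ˡ {i} i∈ = lookup⇒[]= _ _ (trans (lookup-++ˡ p p′ i) ([]=⇒lookup i∈))

  ∈-++⁺ʳ : ∀ {i} → i ∈ˢ p′ → (m ↑ʳ i) ∈ˢ (p ++ p′)
  ∈-++⁺ʳ {i} i∈ = lookup⇒[]= _ _ (trans (lookup-++ʳ p p′ i) ([]=⇒lookup i∈))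

-- Embedding the expansion


module _ (G : BipartiteGraph) (q : ℕ) {n} (H : Hypergraph (3 + q) n) where
  open BipartiteGraph G

  private
    es = edges H
    d = pairDegree es

  module Embedding {T : List (Vec (Fin n) (3 + q))} (T-orders : Pointwise (Orders d) es T)
    (T! : Uniqueˡ T) {s} (deg≤ : ∀ y → degreeOfY y ≤ 2 + s) where

    open Counting T T! using (Star)

    -- A tuple `f` consists of `2 + s` spare entries followed by the images of `X`. The positions
    -- `σ y` are those of the neighbours of `y`, filled up with spare ones to exactly `2 + s`.
    σ : Fin ∣Y∣ → Fin (2 + s) → Fin (2 + s + ∣X∣)
    σ y = completion (neighboursOfY y) (deg≤ y)

    module _ {f : Vec (Fin n) (2 + s + ∣X∣)} (f-inj : Injective _≡_ _≡_ (lookup f))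
      {ys : Fin ∣Y∣ → Vec (Fin n) (2 + q)} (stars : ∀ y → Star (f ⊙ σ y) (ys y))
      (avoids : ∀ y {u} → u ∈ ys y → u ∉ˡ toList f)
      (disjoint : ∀ {i j u} → u ∈ ys i → u ∈ ys j → i ≡ j) where

      φX : Fin ∣X∣ → Fin n
      φX x = lookup f ((2 + s) ↑ʳ x)

      φY : Fin ∣Y∣ × Fin (2 + q) → Fin n
      φY (y , i) = lookup (ys y) i

      φ⊎ : Fin ∣X∣ ⊎ Fin (∣Y∣ * (2 + q)) → Fin n
      φ⊎ (inj₁ x) = φX x
      φ⊎ (inj₂ p) = φY (remQuot (2 + q) p)

      φ : Fin (∣X∣ + ∣Y∣ * (2 + q)) → Fin n
      φ = φ⊎ ∘ splitAt ∣X∣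

      -- A star of a nonempty tuple puts some `w ∷ ys y` into `T`, and the listings in `T` have
      -- distinct entries.
      ys-unique : ∀ y → Unique (ys y)
      ys-unique y with head-star ∷ _ ← stars y with orderings-∈ d T-orders head-star
      ... | _ , _ , o with _ AllPairs.∷ ys! ← Orders.distinct o = ys!

      φX≢φY : ∀ x yi → φX x ≢ φY yi
      φX≢φY x (y , i) eq = avoids y (∈-lookup i (ys y))
        (subst (_∈ˡ toList f) eq (∈-toList⁺ (∈-lookup ((2 + s) ↑ʳ x) f)))

      φY-injective : Injective _≡_ _≡_ φY
      φY-injective {y , i} {y′ , j} eq
        with refl ← disjoint (∈-lookup i (ys y)) (subst (_∈ ys y′) (sym eq) (∈-lookup j (ys y′)))
        = cong (y ,_) (lookup-injective (ys-unique y) i j eq)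

      φ⊎-injective : Injective _≡_ _≡_ φ⊎
      φ⊎-injective {inj₁ x} {inj₁ x′} eq = cong inj₁ (Fin.↑ʳ-injective (2 + s) x x′ (f-inj eq))
      φ⊎-injective {inj₁ x} {inj₂ p}  eq = contradiction eq (φX≢φY x (remQuot (2 + q) p))
      φ⊎-injective {inj₂ p} {inj₁ x}  eq = contradiction (sym eq) (φX≢φY x (remQuot (2 + q) p))
      φ⊎-injective {inj₂ p} {inj₂ p′} eq = cong inj₂ (begin
        p                                     ≡⟨ Fin.combine-remQuot {∣Y∣} (2 + q) p ⟨
        uncurry combine (remQuot {∣Y∣} (2 + q) p)   ≡⟨ cong (uncurry combine) (φY-injective {remQuot (2 + q) p} {remQuot (2 + q) p′} eq) ⟩
        uncurry combine (remQuot {∣Y∣} (2 + q) p′)  ≡⟨ Fin.combine-remQuot {∣Y∣} (2 + q) p′ ⟩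
        p′                                    ∎)
        where open ≡-Reasoning

      φ-injective : Injective _≡_ _≡_ φ
      φ-injective {u} {v} eq = begin
        u                                  ≡⟨ Fin.join-splitAt ∣X∣ _ u ⟨
        join ∣X∣ _ (splitAt ∣X∣ u)     ≡⟨ cong (join ∣X∣ _) (φ⊎-injective {splitAt ∣X∣ u} {splitAt ∣X∣ v} eq) ⟩
        join ∣X∣ _ (splitAt ∣X∣ v)     ≡⟨ Fin.join-splitAt ∣X∣ _ v ⟩
        v                                  ∎
        where open ≡-Reasoning

      -- A neighbour `x` of `y` occupies one of the positions `σ y`, so `φX x` is an entry of
      -- `f ⊙ σ y` and the star supplies the edge.
      star-edge : ∀ {x y} → BipartiteGraph.Edge G (x , y) → (φX x ∷ ys y) ∈ˡ T
      star-edge {x} {y} xy with completion-covers (neighboursOfY y) (deg≤ y) x∈N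
        where
        x∈N = lookup⇒[]= x _ (trans (lookup∘tabulate _ x) (to T-≡ xy))
      ... | i , σi≡x = subst (λ w → (w ∷ ys y) ∈ˡ T)
        (trans (lookup∘tabulate (lookup f ∘ σ y) i) (cong (lookup f) σi≡x))
        (All.lookup (stars y) (∈-lookup i (f ⊙ σ y)))

      -- `φ` sends `x` to the head and the block of `y` onto the entries of `ys y`; together these
      -- are the members of `e`.
      expansionEdge-image : ∀ {x y e} → Orders d e (φX x ∷ ys y) →
        image φ (expansionEdge G (3 + q) (x , y)) ≡ e
      expansionEdge-image {x} {y} {e} o = ⊆-antisym image⊆e e⊆image
        where
        Y′ = block ∣Y∣ (2 + q) y
        image⊆e : ∀ {v} → v ∈ˢ image φ (⁅ x ⁆ ++ Y′) → v ∈ˢ e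
        image⊆e v∈ with ∈-image⁻ φ (⁅ x ⁆ ++ Y′) v∈
        ... | u , u∈ , refl with ∈-++⁻ ⁅ x ⁆ Y′ u∈
        ... | inj₁ (x′ , eq , x′∈) = from (Orders.members o _)
                (hereᵛ (trans (cong φ⊎ eq) (cong φX (x∈⁅y⁆⇒x≡y x x′∈))))
        ... | inj₂ (p , eq , p∈) = from (Orders.members o _) (thereᵛ
                (subst (λ j → φ u ∈ ys j) j≡y (subst (_∈ ys j) (sym (cong φ⊎ eq)) (∈-lookup i (ys j)))))
          where
          j = proj₁ (remQuot {∣Y∣} (2 + q) p)
          i = proj₂ (remQuot {∣Y∣} (2 + q) p)
          j≡y = lookup-block ∣Y∣ (2 + q) y j i
            (trans (cong (lookup Y′) (Fin.combine-remQuot {∣Y∣} (2 + q) p)) ([]=⇒lookup p∈))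
        e⊆image : ∀ {v} → v ∈ˢ e → v ∈ˢ image φ (⁅ x ⁆ ++ Y′)
        e⊆image v∈ with to (Orders.members o _) v∈
        ... | hereᵛ refl = subst (_∈ˢ image φ (⁅ x ⁆ ++ Y′)) (cong φ⊎ (Fin.splitAt-↑ˡ ∣X∣ x _))
                (∈-image⁺ φ (∈-++⁺ˡ ⁅ x ⁆ Y′ (x∈⁅x⁆ x)))
        ... | thereᵛ v∈y = subst (_∈ˢ image φ (⁅ x ⁆ ++ Y′))
                (trans (cong φ⊎ (Fin.splitAt-↑ʳ ∣X∣ _ (combine y i)))
                  (trans (cong φY (Fin.remQuot-combine y i)) (sym (lookup-index v∈y))))
                (∈-image⁺ φ (∈-++⁺ʳ ⁅ x ⁆ Y′ (combine∈block ∣Y∣ (2 + q) y i)))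
          where i = index v∈y

      copy : ∀ 3≤r → Copy (expansion G (3 + q) 3≤r) H
      copy 3≤r = record
        { embed     = φ
        ; injective = φ-injective
        ; preserves = preserves
        }
        where
        preserves : ∀ e → e ∈ˡ expansionEdges G (3 + q) → image φ e ∈ˡ es
        preserves e e∈ with ∈ˡ.∈-map⁻ (expansionEdge G (3 + q)) e∈
        ... | (x , y) , xy∈ , refl
          with orderings-∈ d T-orders (star-edge (proj₂ (∈ˡ.∈-filter⁻ edge?
                 {xs = cartesianProduct (allFin ∣X∣) (allFin ∣Y∣)} xy∈)))
        ... | e′ , e′∈ , o = subst (_∈ˡ es) (sym (expansionEdge-image o)) e′∈

-- The bound for a single hypergraph and the theorem

m≤m^1+k : ∀ m k → m ≤ m ^ suc k
m≤m^1+k zero      k = z≤n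
m≤m^1+k m@(suc _) k = ≤-trans (≤-reflexive (sym (*-identityʳ m))) (*-monoʳ-≤ m (m^n>0 m k))

^-cancelʳ-≤ : ∀ k {x y} → x ^ suc k ≤ y ^ suc k → x ≤ y
^-cancelʳ-≤ k x^≤y^ = ≮⇒≥ λ y<x → <⇒≱ (^-monoˡ-< (suc k) y<x) x^≤y^

module _ (G : BipartiteGraph) (q : ℕ) where
  open BipartiteGraph G

  private
    r = 3 + q
    -- `t` bounds the tuple length `2 + s + ∣X∣` for all `s ≤ ∣X∣`, which keeps the constants
    -- independent of `s`. `K` leaves room for the entries of `f` and for `∣Y∣` disjoint blocks; `θ`
    -- and `c₁` come from `many-bad-tuples`.
    t = 2 + ∣X∣ + ∣X∣
    K = t + ∣Y∣ * (2 + q)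
    θ = 2 * (t * t)
    c₁ = 2 * ∣Y∣
    c₂ = 2 * (2 + r * r)

  -- The first summand serves `dense`, the second `sparse`.
  turánConstant : ℕ
  turánConstant = 2 * c₁ * K * c₂ + θ * c₂

  private
    C = turánConstant

  module _ {n} (1≤n : 1 ≤ n) (H : Hypergraph r n) {3≤r} (free : expansion G r 3≤r -Free H) where
    private
      M = ∣E H ∣
      instance
        n≢0 : NonZero n
        n≢0 = >-nonZero 1≤n

    -- Here M is O(n^(r - 1)), and r - 1 ≤ r - 1/(1 + s).
    sparse : ∀ s → M ≤ θ * (c₂ * (n ^ q * (n * n))) → M ^ (1 + s) ≤ C ^ (1 + s) * n ^ (2 + q + s * (3 + q))
    sparse s M≤ = begin
      M ^ (1 + s)
        ≤⟨ ^-monoˡ-≤ (1 + s) M≤ ⟩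
      (θ * (c₂ * (n ^ q * (n * n)))) ^ (1 + s)
        ≡⟨ cong (_^ (1 + s)) (regroup θ c₂ (n ^ q) n) ⟩
      (θ * c₂ * n ^ (2 + q)) ^ (1 + s)
        ≡⟨ ^-distribʳ-* (1 + s) (θ * c₂) (n ^ (2 + q)) ⟩
      (θ * c₂) ^ (1 + s) * (n ^ (2 + q)) ^ (1 + s)
        ≤⟨ *-mono-≤ (^-monoˡ-≤ (1 + s) (m≤n+m (θ * c₂) (2 * c₁ * K * c₂))) n^≤ ⟩
      C ^ (1 + s) * n ^ (2 + q + s * (3 + q)) ∎
      where
      open ≤-Reasoning
      regroup : ∀ θ c N n → θ * (c * (N * (n * n))) ≡ θ * c * (n * (n * N))
      regroup = solve-∀
      exponent : ∀ q s → (2 + q) * (1 + s) + s ≡ 2 + q + s * (3 + q)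
      exponent = solve-∀
      n^≤ : (n ^ (2 + q)) ^ (1 + s) ≤ n ^ (2 + q + s * (3 + q))
      n^≤ = ≤-trans (≤-reflexive (^-*-assoc n (2 + q) (1 + s)))
        (^-monoʳ-≤ n (≤-trans (m≤m+n _ s) (≤-reflexive (exponent q s))))

    module _ {s} (s≤X : s ≤ ∣X∣) (deg≤ : ∀ y → degreeOfY y ≤ 2 + s) where
      open ≤-Reasoning

      private
        d = pairDegree (edges H)
        T = proj₁ (orderings d q (uniform H))
        T-orders = proj₂ (orderings d q (uniform H))
        T! = orderings-unique d T-orders (unique H)
        open Counting T T! using (nbrs; degree; headCodegree; codegree; ∑-weight*#bad; M^≤; #bad)
        open Embedding G q H T-orders T! deg≤ using (σ; copy)

        t′ = 2 + s + ∣X∣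
        t′≤t : t′ ≤ t
        t′≤t = +-monoˡ-≤ ∣X∣ (+-monoʳ-≤ 2 s≤X)

        Bad? : Decidable (Blocked T T! K {2 + s})
        Bad? = blocked? T T! K

        M≡ : length T ≡ M
        M≡ = sym (Pointwise-length T-orders)

      heavy : ∀ {w u y} → (w ∷ y) ∈ˡ T → u ∈ y → codegree w u ≤ headCodegree y
      heavy {w} {u} {x ∷ v ∷ _} τ∈ u∈ with orderings-∈ d T-orders τ∈
      ... | _ , _ , o = begin
        codegree w u   ≡⟨ pairDegree≡codegree T! T-orders w u ⟨
        d w u          ≤⟨ Orders.heaviest o u∈ ⟩
        d x v          ≡⟨ pairDegree≡codegree T! T-orders x v ⟩
        codegree x v   ∎

      -- If no `f ⊙ σ y` were blocked, disjoint stars avoiding `f` would complete `f` to a copy of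
      -- the expansion.
      some-blocked : ∀ f → Injective _≡_ _≡_ (lookup f) → ∃[ y ] Blocked T T! K (f ⊙ σ y)
      some-blocked f f-inj with Fin.any? (λ y → Bad? (f ⊙ σ y))
      ... | yes b = b
      ... | no ¬b with disjoint-stars T T! K ∣Y∣ (λ y → f ⊙ σ y) (λ y b → ¬b (y , b)) (toList f)
                         (+-monoˡ-≤ (∣Y∣ * (2 + q)) (≤-trans (≤-reflexive (length-toList f)) t′≤t))
      ... | ys , stars , avoids , disjoint =
        contradiction (copy f-inj stars avoids disjoint 3≤r) free

      many : ∀ y → θ ≤ degree y →
        degree y ^ (2 + s) ≤ c₁ * ∑[ S ← tuples (nbrs y) (2 + s) ] 𝟙 (Bad? S)
      many y θ≤ = many-bad-tuples Fin._≟_ (Uniqueˡ.filter⁺ _ (Uniqueˡ.allFin⁺ n)) s ∣X∣ σ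
        (λ y → completion-injective (neighboursOfY y) (deg≤ y)) Bad? some-blocked
        (≤-trans (*-monoʳ-≤ 2 (*-mono-≤ t′≤t t′≤t)) θ≤)

      dense : θ * (c₂ * (n ^ q * (n * n))) ≤ M → M ^ (1 + s) ≤ C ^ (1 + s) * n ^ (2 + q + s * (3 + q))
      dense M≥ = begin
        M ^ (1 + s)
          ≡⟨ cong (_^ (1 + s)) M≡ ⟨
        length T ^ (1 + s)
          ≤⟨ M^≤ 1≤n {θ} (s≤s z≤n) (≤-trans M≥ (≤-reflexive (sym M≡))) {s} {c₁}
               (#bad heavy {K = K} Bad? (blocked⇒transversal T T! K)) many {K}
               (∑-weight*#bad heavy {K = K} Bad? (blocked⇒transversal T T! K)) ⟩
        2 * c₁ * K * c₂ ^ (1 + s) * n ^ (2 + q + s * (3 + q))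
          ≤⟨ *-monoˡ-≤ (n ^ (2 + q + s * (3 + q))) (begin
               -- `C` stands under the power `1 + s`, so the linear factor is raised to that power
               -- as well.
               2 * c₁ * K * c₂ ^ (1 + s)             ≤⟨ *-monoˡ-≤ (c₂ ^ (1 + s)) (m≤m^1+k (2 * c₁ * K) s) ⟩
               (2 * c₁ * K) ^ (1 + s) * c₂ ^ (1 + s) ≡⟨ ^-distribʳ-* (1 + s) (2 * c₁ * K) c₂ ⟨
               (2 * c₁ * K * c₂) ^ (1 + s)           ≤⟨ ^-monoˡ-≤ (1 + s) (m≤m+n (2 * c₁ * K * c₂) (θ * c₂)) ⟩
               C ^ (1 + s)                           ∎) ⟩
        C ^ (1 + s) * n ^ (2 + q + s * (3 + q)) ∎

      turán-bound : M ^ (1 + s) ≤ C ^ (1 + s) * n ^ (2 + q + s * (3 + q))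
      turán-bound with ≤-total M (θ * (c₂ * (n ^ q * (n * n))))
      ... | inj₁ M≤ = sparse s M≤
      ... | inj₂ M≥ = dense M≥

-- The bound M ≤ C n^(r - 1/(1 + s)) weakens as s grows.
exponent-mono : ∀ {M C n} q {s s′} → 1 ≤ n → s ≤ s′ →
  M ^ (1 + s) ≤ C ^ (1 + s) * n ^ (2 + q + s * (3 + q)) →
  M ^ (1 + s′) ≤ C ^ (1 + s′) * n ^ (2 + q + s′ * (3 + q))
exponent-mono {M} {C} {n} q {s} {s′} 1≤n s≤s′ bound = ^-cancelʳ-≤ s (begin
  (M ^ (1 + s′)) ^ (1 + s)
    ≡⟨ ^-swap M (1 + s′) (1 + s) ⟩
  (M ^ (1 + s)) ^ (1 + s′)
    ≤⟨ ^-monoˡ-≤ (1 + s′) bound ⟩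
  (C ^ (1 + s) * n ^ e) ^ (1 + s′)
    ≡⟨ ^-distribʳ-* (1 + s′) (C ^ (1 + s)) (n ^ e) ⟩
  (C ^ (1 + s)) ^ (1 + s′) * (n ^ e) ^ (1 + s′)
    ≤⟨ *-mono-≤ (≤-reflexive (^-swap C (1 + s) (1 + s′))) n^≤ ⟩
  (C ^ (1 + s′)) ^ (1 + s) * (n ^ e′) ^ (1 + s)
    ≡⟨ ^-distribʳ-* (1 + s) (C ^ (1 + s′)) (n ^ e′) ⟨
  (C ^ (1 + s′) * n ^ e′) ^ (1 + s) ∎)
  where
  open ≤-Reasoning
  e = 2 + q + s * (3 + q)
  e′ = 2 + q + s′ * (3 + q)
  ^-swap : ∀ x a b → (x ^ a) ^ b ≡ (x ^ b) ^ a
  ^-swap x a b = trans (^-*-assoc x a b) (trans (cong (x ^_) (*-comm a b)) (sym (^-*-assoc x b a)))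
  -- This is r - 1/(1 + s) ≤ r - 1/(1 + s′) with denominators cleared; the two sides differ by v =
  -- s′ - s.
  crossMultiply : ∀ q s v → (2 + q + s * (3 + q)) * (1 + (s + v)) + v ≡
    (2 + q + (s + v) * (3 + q)) * (1 + s)
  crossMultiply = solve-∀
  exponents : e * (1 + s′) ≤ e′ * (1 + s)
  exponents with v , refl ← m≤n⇒∃[o]m+o≡n s≤s′ =
    ≤-trans (m≤m+n _ v) (≤-reflexive (crossMultiply q s v))
  n^≤ : (n ^ e) ^ (1 + s′) ≤ (n ^ e′) ^ (1 + s)
  n^≤ = begin
    (n ^ e) ^ (1 + s′)   ≡⟨ ^-*-assoc n e (1 + s′) ⟩
    n ^ (e * (1 + s′))   ≤⟨ ^-monoʳ-≤ n {{>-nonZero 1≤n}} exponents ⟩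
    n ^ (e′ * (1 + s))   ≡⟨ ^-*-assoc n e′ (1 + s) ⟨
    (n ^ e′) ^ (1 + s)   ∎

theorem1p4 : (G : BipartiteGraph) (r : ℕ) (3≤r : 3 ≤ r) →
    ∃[ C ] ((s : ℕ) → 2 ≤ s →
    (∀ y → BipartiteGraph.degreeOfY G y ≤ s) →
    ∀ n → 1 ≤ n → ∀ k → IsEx n (expansion G r 3≤r) k →
    k ≤ C · n ^[ (r * (s ∸ 1) ∸ 1) / (s ∸ 1) ])
theorem1p4 G (suc (suc (suc q))) 3≤r@(s≤s (s≤s (s≤s z≤n))) = C , bound
  where
  open BipartiteGraph G
  C = turánConstant G q

  -- The left side is what r (1 + s) ∸ 1 evaluates to for r = 3 + q.
  exponent : ∀ q s → s + (2 + q) * (1 + s) ≡ 2 + q + s * (3 + q)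
  exponent = solve-∀

  bound : (s : ℕ) → 2 ≤ s → (∀ y → degreeOfY y ≤ s) →
    ∀ n → 1 ≤ n → ∀ k → IsEx n (expansion G (3 + q) 3≤r) k →
    k ≤ C · n ^[ ((3 + q) * (s ∸ 1) ∸ 1) / (s ∸ 1) ]
  bound (suc (suc s)) (s≤s (s≤s z≤n)) deg≤ n 1≤n k isEx with IsEx.attained isEx
  ... | H , free , refl = subst (λ e → ∣E H ∣ ^ (1 + s) ≤ C ^ (1 + s) * n ^ e) (sym (exponent q s)) M≤
    where
    M≤ : ∣E H ∣ ^ (1 + s) ≤ C ^ (1 + s) * n ^ (2 + q + s * (3 + q))
    -- `C` is fixed before `s`, so large `s` are reduced to `∣X∣`: no degree exceeds `∣X∣`, and the
    -- bound obtained there is at least as strong.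
    M≤ with ≤-total s ∣X∣
    ... | inj₁ s≤X = turán-bound G q 1≤n H {3≤r} free s≤X deg≤
    ... | inj₂ X≤s = exponent-mono {M = ∣E H ∣} {C} q 1≤n X≤s
          (turán-bound G q 1≤n H {3≤r} free ≤-refl
            λ y → ≤-trans (∣p∣≤n (neighboursOfY y)) (m≤n+m ∣X∣ 2))
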